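{- Let $\Gamma$ be a finite, simple, strongly connected digraph of order $n\geq 4$ which is not an undirected graph. Then $\dim(\Gamma)=n-2$ if and only if $\Gamma$ is isomorphic to one of $G_2[K_1,P_2,K_1]$, $G_1[K_1,K_t,K_{n-t-1}]$, $G_2[K_1,K_t,K_{n-t-1}]$, $G_2[K_t,K_{n-t-1},K_1]$, or $G_2[K_1,\overline{K}_{n-2},K_1]$ for some integer $t$ with $1\leq t\leq n-2$.
   Context: All digraphs are finite, simple (no loops, at most one arc from $x$ to $y$ for each ordered pair) and strongly connected. $\partial(x,y)$ is the length of a shortest directed path from $x$ to $y$; $\tilde\partial(x,y)=(\partial(x,y),\partial(y,x))$. A subset $\{w_1,\dots,w_m\}$ of $V(\Gamma)$ is a weakly resolving set if $(\tilde\partial(w_1,u),\dots,\tilde\partial(w_m,u))\neq(\tilde\partial(w_1,v),\dots,\tilde\partial(w_m,v))$ for all distinct vertices $u,v$; $\dim(\Gamma)$ (weak metric dimension) is the minimum size of a weakly resolving set. A digraph is an undirected graph if for every arc $(x,y)$, $(y,x)$ is also an arc. $K_t$ is the complete digraph on $t$ vertices (all ordered pairs of distinct vertices are arcs), $\overline{K}_t$ the digraph on $t$ vertices with no arcs, and $P_2$ the digraph on two vertices $a,b$ with the single arc $(a,b)$. $G_1$ is the digraph on $\{0,1,2\}$ with arcs $(0,1),(1,2),(2,1),(2,0)$; $G_2$ is the digraph on $\{0,1,2\}$ with arcs $(0,1),(1,0),(1,2),(2,1),(2,0)$. For a digraph $G$ on $\{0,1,\dots,m-1\}$ and digraphs $H_0,\dots,H_{m-1}$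 with disjoint vertex sets, the generalized lexicographic product $G[H_0,\dots,H_{m-1}]$ has vertex set $V(H_0)\cup\dots\cup V(H_{m-1})$, and for $x\in V(H_i)$, $y\in V(H_j)$ there is an arc $(x,y)$ iff either $i=j$ and $(x,y)$ is an arc of $H_i$, or $i\neq j$ and $(i,j)$ is an arc of $G$. -}

module Defs where

open import Data.Nat using (ℕ; zero; suc; _≤_; _∸_)
open import Data.Bool using (Bool; true; false; not)
open import Data.Fin using (Fin; zero; suc; _≟_)
open import Data.Fin.Subset using (Subset; _∈_; ∣_∣)
open import Data.Product using (Σ; ∃; ∃-syntax; _×_; _,_)
open import Data.Sum using (_⊎_)
open import Function.Bundles using (_↔_; Inverse)
open import Relation.Nullary using (¬_; yes; no)
open import Relation.Nullary.Decidable using (⌊_⌋)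
open import Relation.Binary.PropositionalEquality using (_≡_; _≢_; refl)

-- A digraph on vertex type V: arc x y ≡ true iff (x , y) is an arc.
-- (Simplicity "at most one arc x→y" is built in.)
Digraph : Set → Set
Digraph V = V → V → Bool

Loopless : {V : Set} → Digraph V → Set
Loopless {V} A = ∀ (x : V) → A x x ≡ false

data Walk {V : Set} (A : Digraph V) : V → V → ℕ → Set where
  nil  : ∀ {x} → Walk A x x 0
  cons : ∀ {x y z k} → A x y ≡ true → Walk A y z k → Walk A x z (suc k)

StronglyConnected : {V : Set} → Digraph V → Set
StronglyConnected {V} A = ∀ (x y : V) → ∃[ k ] Walk A x y k

Undirected : {V : Set} → Digraph V → Set
Undirected {V} A = ∀ (x y : V) → A x y ≡ true → A y x ≡ true

IsDist : {V : Set} → Digraph V → V → V → ℕ → Set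
IsDist A x y d = Walk A x y d × (∀ m → Data.Nat._<_ m d → ¬ Walk A x y m)

Distinguishes : {V : Set} → Digraph V → V → V → V → Set
Distinguishes A w u v =
  ∃[ d₁ ] ∃[ d₂ ] ∃[ e₁ ] ∃[ e₂ ]
    (IsDist A w u d₁ × IsDist A w v d₂ × IsDist A u w e₁ × IsDist A v w e₂
     × ((d₁ , e₁) ≢ (d₂ , e₂)))

WeaklyResolving : {n : ℕ} → Digraph (Fin n) → Subset n → Set
WeaklyResolving {n} A W =
  ∀ (u v : Fin n) → u ≢ v → ∃[ w ] (w ∈ W × Distinguishes A w u v)

HasDim : {n : ℕ} → Digraph (Fin n) → ℕ → Set
HasDim {n} A k =
  (∃[ W ] (WeaklyResolving A W × ∣ W ∣ ≡ k))
  × (∀ (W : Subset n) → WeaklyResolving A W → k ≤ ∣ W ∣)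

Iso : {V U : Set} → Digraph V → Digraph U → Set
Iso {V} {U} A B = Σ (V ↔ U) λ f → ∀ (x y : V) → A x y ≡ B (Inverse.to f x) (Inverse.to f y)

K : (t : ℕ) → Digraph (Fin t)
K t x y = not ⌊ x ≟ y ⌋

Kbar : (t : ℕ) → Digraph (Fin t)
Kbar t x y = false

P2 : Digraph (Fin 2)
P2 zero (suc zero) = true
P2 _ _ = false

G1 : Digraph (Fin 3)
G1 zero (suc zero) = true
G1 (suc zero) (suc (suc zero)) = true
G1 (suc (suc zero)) (suc zero) = true
G1 (suc (suc zero)) zero = true
G1 _ _ = false

G2 : Digraph (Fin 3)
G2 zero (suc zero) = true
G2 (suc zero) zero = true
G2 (suc zero) (suc (suc zero)) = true
G2 (suc (suc zero)) (suc zero) = true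
G2 (suc (suc zero)) zero = true
G2 _ _ = false

Lex : {m : ℕ} (G : Digraph (Fin m)) (s : Fin m → ℕ) (H : (i : Fin m) → Digraph (Fin (s i)))
    → Digraph (Σ (Fin m) λ i → Fin (s i))
Lex G s H (i , x) (j , y) with i ≟ j
... | yes refl = H i x y
... | no _ = G i j

size3 : ℕ → ℕ → ℕ → Fin 3 → ℕ
size3 a b c zero = a
size3 a b c (suc zero) = b
size3 a b c (suc (suc zero)) = c

comp3 : {a b c : ℕ} → Digraph (Fin a) → Digraph (Fin b) → Digraph (Fin c)
      → (i : Fin 3) → Digraph (Fin (size3 a b c i))
comp3 H₀ H₁ H₂ zero = H₀
comp3 H₀ H₁ H₂ (suc zero) = H₁
comp3 H₀ H₁ H₂ (suc (suc zero)) = H₂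

Lex3 : (G : Digraph (Fin 3)) {a b c : ℕ} → Digraph (Fin a) → Digraph (Fin b) → Digraph (Fin c)
     → Digraph (Σ (Fin 3) λ i → Fin (size3 a b c i))
Lex3 G {a} {b} {c} H₀ H₁ H₂ = Lex G (size3 a b c) (comp3 H₀ H₁ H₂)

Extremal : (n : ℕ) → Digraph (Fin n) → Set
Extremal n A =
  Iso A (Lex3 G2 (K 1) P2 (K 1))
  ⊎ (∃[ t ] (1 ≤ t × t ≤ n ∸ 2 ×
       (Iso A (Lex3 G1 (K 1) (K t) (K (n ∸ t ∸ 1)))
        ⊎ Iso A (Lex3 G2 (K 1) (K t) (K (n ∸ t ∸ 1)))
        ⊎ Iso A (Lex3 G2 (K t) (K (n ∸ t ∸ 1)) (K 1)))))
  ⊎ Iso A (Lex3 G2 (K 1) (Kbar (n ∸ 2)) (K 1))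

{-# OPTIONS --safe #-}
module Submission where

-- No set of n − 3 vertices is resolving iff every three vertices contain two that no vertex
-- outside the three tells apart.  Applied to the first three vertices of a geodesic this bounds
-- the diameter by 2, so distances are determined by arcs and the condition becomes one about the
-- types τ(w,v) = (w → v , v → w): every vertex w sees at most two types, and if it sees two, then
-- vertices of the same type are twins up to one vertex of the other type.
-- Suppose w has two out-only neighbours.  By the diameter bound the other type at w contains an
-- in-arc, and the twin conditions force all vertices other than w to be mutually adjacent: this
-- gives G₁[K₁,K,K] or G₂[K,K,K₁], and G₂[K₁,K,K] for the reversed digraph.  If no vertex
-- has two out-only or two in-only neighbours, the ends of a one-way arc are joined in both
-- directions to all other vertices, and these are mutual twins, so they induce K or K̄, or P₂ when there are only two of them.
-- Conversely all five families are blow-ups of digraphs on at most four colours, for which the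
-- twin condition and the diameter bound are finite checks on the colours.

open import Defs
open import Data.Bool using (Bool; true; false; if_then_else_)
import Data.Bool.Properties as Bool
open import Data.Fin using (Fin; zero; suc; _≟_; cast)
open import Data.Fin.Patterns using (0F; 1F; 2F; 3F)
open import Data.Fin.Properties using (any?; all?; cast-involutive)
open import Data.Fin.Subset using (Subset; _∈_; _∉_; ∣_∣; _∪_; ⁅_⁆; ∁; inside; outside)
import Data.Fin.Subset.Properties as Subset
open import Data.Nat using (ℕ; zero; suc; _+_; _≤_; _<_; _∸_; z≤n; s≤s; s<s⁻¹; _≤?_)
import Data.Nat.Properties as ℕ
open import Data.Product using (Σ; ∃; ∃-syntax; _×_; _,_; proj₁; proj₂; swap)
open import Data.Product.Properties using (≡-dec)
open import Data.Sum using (_⊎_; inj₁; inj₂; [_,_]′) renaming (map to ⊎-map)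
open import Data.Vec using (_∷_; here; there)
open import Function using (_∘_; flip; case_of_)
open import Function.Bundles using (_⇔_; Inverse; mk⇔; mk↔ₛ′)
open import Relation.Binary.Definitions using (tri<; tri≈; tri>)
open import Relation.Binary.PropositionalEquality using (_≡_; _≢_; refl; sym; trans; cong; cong₂; subst; ≢-sym)
open import Relation.Nullary using (¬_; Dec; yes; no; contradiction)
open import Relation.Nullary.Decidable using (map′; _×-dec_; _⊎-dec_; _→-dec_; ¬?; toWitness; True)

private
  variable
    m n : ℕ

  true≢false : true ≢ false
  true≢false ()

-- Types and twins.

τ : {V : Set} → Digraph V → V → V → Bool × Bool
τ A w v = A w v , A v w

-- The first argument `z` is exempt, being the third member of the triple: a set disjoint from all
-- of `x`, `y`, `z` cannot tell `x` from `y` by types.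
Twins : {V : Set} → Digraph V → V → V → V → Set
Twins A z x y = ∀ w → w ≢ x → w ≢ y → w ≢ z → τ A w x ≡ τ A w y

TwinTriples : {V : Set} → Digraph V → Set
TwinTriples A = ∀ x y z → x ≢ y → x ≢ z → y ≢ z → Twins A z x y ⊎ Twins A y x z ⊎ Twins A x y z

Diameter≤2 : {V : Set} → Digraph V → Set
Diameter≤2 A = ∀ x y → x ≢ y → A x y ≡ true ⊎ ∃[ m ] (A x m ≡ true × A m y ≡ true)

-- Distances

arc⇒≢ : {V : Set} {A : Digraph V} → Loopless A → ∀ {x y} → A x y ≡ true → x ≢ y
arc⇒≢ loopless {x} a refl = true≢false (trans (sym a) (loopless x))

isDist-unique : {V : Set} {A : Digraph V} {x y : V} {d e : ℕ} → IsDist A x y d → IsDist A x y e → d ≡ e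
isDist-unique {d = d} {e} (p , minp) (q , minq) with ℕ.<-cmp d e
... | tri< d<e _ _ = contradiction p (minq d d<e)
... | tri≈ _ d≡e _ = d≡e
... | tri> _ _ e<d = contradiction q (minp e e<d)

isDist-refl : {V : Set} {A : Digraph V} {x : V} → IsDist A x x 0
isDist-refl = nil , λ _ ()

isDist-zero : {V : Set} {A : Digraph V} {x y : V} → IsDist A x y 0 → x ≡ y
isDist-zero (nil , _) = refl

isDist-one : {V : Set} {A : Digraph V} {x y : V} → IsDist A x y 1 → A x y ≡ true
isDist-one (cons a nil , _) = a

isDist-arc : {V : Set} {A : Digraph V} {x y : V} → x ≢ y → A x y ≡ true → IsDist A x y 1
isDist-arc {A = A} {x} {y} x≢y a = cons a nil , shorter
  where
  shorter : ∀ k → k < 1 → ¬ Walk A x y k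
  shorter zero _ nil = x≢y refl
  shorter (suc _) (s≤s ())

isDist-no-arc : {V : Set} {A : Digraph V} → Diameter≤2 A → ∀ {x y} → x ≢ y → A x y ≡ false → IsDist A x y 2
isDist-no-arc {A = A} diam {x} {y} x≢y ¬a with diam x y x≢y
... | inj₁ a = contradiction (trans (sym a) ¬a) true≢false
... | inj₂ (_ , a , b) = cons a (cons b nil) , shorter
  where
  shorter : ∀ k → k < 2 → ¬ Walk A x y k
  shorter zero _ nil = x≢y refl
  shorter (suc zero) _ (cons c nil) = true≢false (trans (sym c) ¬a)
  shorter (suc (suc _)) (s≤s (s≤s ()))

-- With diameter at most 2, distinct vertices are at distance 1 or 2 according to the arc bit alone,
-- so types determine distances.
isDist-cong : {V : Set} {A : Digraph V} → Diameter≤2 A → ∀ {x y x′ y′ d e} → x ≢ y → x′ ≢ y′ →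
  A x y ≡ A x′ y′ → IsDist A x y d → IsDist A x′ y′ e → d ≡ e
isDist-cong {A = A} diam {x} {y} x≢y x′≢y′ eq p q with A x y in a
... | true = trans (isDist-unique p (isDist-arc x≢y a))
                   (isDist-unique (isDist-arc x′≢y′ (sym eq)) q)
... | false = trans (isDist-unique p (isDist-no-arc diam x≢y a))
                    (isDist-unique (isDist-no-arc diam x′≢y′ (sym eq)) q)

walk? : (A : Digraph (Fin n)) → ∀ x y k → Dec (Walk A x y k)
walk? A x y zero = map′ (λ { refl → nil }) (λ { nil → refl }) (x ≟ y)
walk? A x y (suc k) =
  map′ (λ { (_ , a , p) → cons a p }) (λ { (cons a p) → _ , a , p })
       (any? λ z → (A x z Bool.≟ true) ×-dec walk? A z y k)

-- Strong connectivity only gives some walk; the least length is found by searching the decidable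
-- walk predicate upwards.
distance : {A : Digraph (Fin n)} → StronglyConnected A → ∀ x y → ∃ (IsDist A x y)
distance {A = A} connected x y with connected x y
-- The search covers lengths below its argument, so `suc k` makes it inspect the length `k` of the
-- known walk.
... | k , p = case search (suc k) of λ
    { (inj₁ d) → d ; (inj₂ none) → contradiction p (none k ℕ.≤-refl) }
  where
  search : ∀ k → ∃ (IsDist A x y) ⊎ (∀ i → i < k → ¬ Walk A x y i)
  search zero = inj₂ λ _ ()
  search (suc k) with search k
  ... | inj₁ d = inj₁ d
  ... | inj₂ none with walk? A x y k
  ... | yes p = inj₁ (k , p , none)
  ... | no ¬p = inj₂ λ i i≤k → case ℕ.m≤n⇒m<n∨m≡n (ℕ.≤-pred i≤k) of λ
        { (inj₁ i<k) → none i i<k ; (inj₂ refl) → ¬p }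

-- Finite subsets

∣p∪⁅x⁆∣≡1+∣p∣ : (p : Subset n) {x : Fin n} → x ∉ p → ∣ p ∪ ⁅ x ⁆ ∣ ≡ suc ∣ p ∣
∣p∪⁅x⁆∣≡1+∣p∣ (inside ∷ p) {zero} x∉p = contradiction here x∉p
∣p∪⁅x⁆∣≡1+∣p∣ (outside ∷ p) {zero} x∉p = cong (suc ∘ ∣_∣) (Subset.∪-identityʳ p)
∣p∪⁅x⁆∣≡1+∣p∣ (inside ∷ p) {suc x} x∉p = cong suc (∣p∪⁅x⁆∣≡1+∣p∣ p (x∉p ∘ there))
∣p∪⁅x⁆∣≡1+∣p∣ (outside ∷ p) {suc x} x∉p = ∣p∪⁅x⁆∣≡1+∣p∣ p (x∉p ∘ there)

outsider : (p : Subset n) → ∣ p ∣ < n → ∃ (_∉ p)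
outsider (outside ∷ p) _ = zero , λ ()
outsider (inside ∷ p) p<n with outsider p (s<s⁻¹ p<n)
... | x , x∉p = suc x , λ { (there x∈p) → x∉p x∈p }

pair : Fin n → Fin n → Subset n
pair x y = ⁅ x ⁆ ∪ ⁅ y ⁆

∣pair∣ : {x y : Fin n} → x ≢ y → ∣ pair x y ∣ ≡ 2
∣pair∣ {x = x} x≢y = trans (∣p∪⁅x⁆∣≡1+∣p∣ ⁅ x ⁆ (Subset.x≢y⇒x∉⁅y⁆ (≢-sym x≢y))) (cong suc (Subset.∣⁅x⁆∣≡1 x))

∈-pair⁻ : {u x y : Fin n} → u ∈ pair x y → u ≡ x ⊎ u ≡ y
∈-pair⁻ {x = x} {y} u∈ = ⊎-map (Subset.x∈⁅y⁆⇒x≡y x) (Subset.x∈⁅y⁆⇒x≡y y) (Subset.x∈p∪q⁻ ⁅ x ⁆ ⁅ y ⁆ u∈)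

∉-∪⁻ : (p : Subset n) {u x : Fin n} → u ∉ p ∪ ⁅ x ⁆ → u ∉ p × u ≢ x
∉-∪⁻ p {x = x} u∉ = u∉ ∘ Subset.p⊆p∪q ⁅ x ⁆ ,
  λ { refl → u∉ (Subset.q⊆p∪q p ⁅ x ⁆ (Subset.x∈⁅x⁆ x)) }

triple : Fin n → Fin n → Fin n → Subset n
triple x y z = pair x y ∪ ⁅ z ⁆

∣triple∣ : {x y z : Fin n} → x ≢ y → x ≢ z → y ≢ z → ∣ triple x y z ∣ ≡ 3
∣triple∣ {x = x} {y} {z} x≢y x≢z y≢z =
  trans (∣p∪⁅x⁆∣≡1+∣p∣ (pair x y) ([ ≢-sym x≢z , ≢-sym y≢z ]′ ∘ ∈-pair⁻)) (cong suc (∣pair∣ x≢y))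

∈-triple⁻ : {u x y z : Fin n} → u ∈ triple x y z → u ≡ x ⊎ u ≡ y ⊎ u ≡ z
∈-triple⁻ {x = x} {y} {z} u∈ with Subset.x∈p∪q⁻ (pair x y) ⁅ z ⁆ u∈
... | inj₂ u∈z = inj₂ (inj₂ (Subset.x∈⁅y⁆⇒x≡y z u∈z))
... | inj₁ u∈xy with ∈-pair⁻ u∈xy
... | inj₁ u≡x = inj₁ u≡x
... | inj₂ u≡y = inj₂ (inj₁ u≡y)

∉-triple⁺ : {u x y z : Fin n} → u ≢ x → u ≢ y → u ≢ z → u ∉ triple x y z
∉-triple⁺ u≢x u≢y u≢z = [ u≢x , [ u≢y , u≢z ]′ ]′ ∘ ∈-triple⁻

∉-triple⁻ : {u x y z : Fin n} → u ∉ triple x y z → u ≢ x × u ≢ y × u ≢ z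
∉-triple⁻ {x = x} {y} u∉ with ∉-∪⁻ (pair x y) u∉
... | u∉xy , u≢z with ∉-∪⁻ ⁅ x ⁆ u∉xy
... | u∉x , u≢y = Subset.x∉⁅y⁆⇒x≢y u∉x , u≢y , u≢z

three-outsiders : (p : Subset n) → 2 + ∣ p ∣ < n →
  ∃[ x ] ∃[ y ] ∃[ z ] (x ≢ y × x ≢ z × y ≢ z × x ∉ p × y ∉ p × z ∉ p)
three-outsiders p lt with outsider p (ℕ.<-trans (ℕ.n<1+n _) (ℕ.<-trans (ℕ.n<1+n _) lt))
... | x , x∉p with outsider (p ∪ ⁅ x ⁆) (subst (_< _) (sym (∣p∪⁅x⁆∣≡1+∣p∣ p x∉p)) (ℕ.<-trans (ℕ.n<1+n _) lt))
... | y , y∉ with outsider (p ∪ ⁅ x ⁆ ∪ ⁅ y ⁆)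
                  (subst (_< _) (sym (trans (cong ∣_∣ (sym (Subset.∪-assoc p ⁅ x ⁆ ⁅ y ⁆)))
                    (trans (∣p∪⁅x⁆∣≡1+∣p∣ (p ∪ ⁅ x ⁆) y∉) (cong suc (∣p∪⁅x⁆∣≡1+∣p∣ p x∉p))))) lt)
... | z , z∉ with ∉-∪⁻ p y∉ | ∉-∪⁻ (p ∪ ⁅ x ⁆) (subst (z ∉_) (sym (Subset.∪-assoc p ⁅ x ⁆ ⁅ y ⁆)) z∉)
... | y∉p , y≢x | z∉px , z≢y with ∉-∪⁻ p z∉px
... | z∉p , z≢x = x , y , z , ≢-sym y≢x , ≢-sym z≢x , ≢-sym z≢y , x∉p , y∉p , z∉p

-- Weak metric dimension n − 2

module _ {A : Digraph (Fin n)} (connected : StronglyConnected A) where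

  private
    d : Fin n → Fin n → ℕ
    d x y = proj₁ (distance connected x y)

    isDist-d : ∀ x y → IsDist A x y (d x y)
    isDist-d x y = proj₂ (distance connected x y)

    d-self : ∀ x → d x x ≡ 0
    d-self x = isDist-unique (isDist-d x x) isDist-refl

    d-zero : ∀ {x y} → d x y ≡ 0 → x ≡ y
    d-zero {x} {y} eq = isDist-zero (subst (IsDist A x y) eq (isDist-d x y))

    -- The two-way distance, whose values a weakly resolving set compares.
    δ : Fin n → Fin n → ℕ × ℕ
    δ w v = d w v , d v w

    DTwins : Fin n → Fin n → Fin n → Set
    DTwins z x y = ∀ w → w ≢ x → w ≢ y → w ≢ z → δ w x ≡ δ w y

    -- A member of `W` is at distance 0 only from itself, so it separates itself from every other
    -- vertex and only pairs outside `W` remain.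
    resolving : (W : Subset n) →
      (∀ u v → u ≢ v → u ∉ W → v ∉ W → ∃[ w ] (w ∈ W × δ w u ≢ δ w v)) → WeaklyResolving A W
    resolving W separated u v u≢v with witness
      where
      witness : ∃[ w ] (w ∈ W × δ w u ≢ δ w v)
      witness with u Subset.∈? W | v Subset.∈? W
      ... | yes u∈W | _ = u , u∈W , λ eq → u≢v (d-zero (trans (sym (cong proj₁ eq)) (d-self u)))
      ... | no _ | yes v∈W = v , v∈W , λ eq → u≢v (sym (d-zero (trans (cong proj₁ eq) (d-self v))))
      ... | no u∉W | no v∉W = separated u v u≢v u∉W v∉W
    ... | w , w∈W , δ≢ = w , w∈W , d w u , d w v , d u w , d v w ,
          isDist-d w u , isDist-d w v , isDist-d u w , isDist-d v w , δ≢

    -- Between distinct vertices an arc means exactly distance 1, so equal distances give equal arc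
    -- bits.
    dtwins⇒twins : ∀ {z x y} → DTwins z x y → Twins A z x y
    dtwins⇒twins dtwins w w≢x w≢y w≢z =
      cong₂ _,_ (arc (cong proj₁ eq) w≢x w≢y) (arc (cong proj₂ eq) (≢-sym w≢x) (≢-sym w≢y))
      where
      eq = dtwins w w≢x w≢y w≢z

      arc-d : ∀ {u v u′ v′} → d u v ≡ d u′ v′ → u ≢ v → A u v ≡ true → A u′ v′ ≡ true
      arc-d {u} {v} {u′} {v′} eq u≢v a = isDist-one (subst (IsDist A u′ v′)
        (trans (sym eq) (isDist-unique (isDist-d u v) (isDist-arc u≢v a))) (isDist-d u′ v′))

      arc : ∀ {u v u′ v′} → d u v ≡ d u′ v′ → u ≢ v → u′ ≢ v′ → A u v ≡ A u′ v′
      arc {u} {v} {u′} {v′} eq u≢v u′≢v′ with A u v in a | A u′ v′ in a′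
      ... | true | true = refl
      ... | false | false = refl
      ... | true | false = trans (sym (arc-d eq u≢v a)) a′
      ... | false | true = trans (sym a) (arc-d (sym eq) u′≢v′ a′)

    module _ (4≤n : 4 ≤ n) (minimal : ∀ W → WeaklyResolving A W → n ∸ 2 ≤ ∣ W ∣) where

      Separated : Fin n → Fin n → Fin n → Set
      Separated z x y = ∃[ w ] (w ≢ x × w ≢ y × w ≢ z × δ w x ≢ δ w y)

      separated? : ∀ z x y → Dec (Separated z x y)
      separated? z x y = any? λ w → ¬? (w ≟ x) ×-dec ¬? (w ≟ y) ×-dec ¬? (w ≟ z) ×-dec ¬? (≡-dec ℕ._≟_ ℕ._≟_ (δ w x) (δ w y))

      unseparated⇒dtwins : ∀ {z x y} → ¬ Separated z x y → DTwins z x y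
      unseparated⇒dtwins {z} {x} {y} ¬sep w w≢x w≢y w≢z with ≡-dec ℕ._≟_ ℕ._≟_ (δ w x) (δ w y)
      ... | yes eq = eq
      ... | no neq = contradiction (w , w≢x , w≢y , w≢z , neq) ¬sep

      complement-not-resolving : ∀ {x y z} → x ≢ y → x ≢ z → y ≢ z →
        ¬ WeaklyResolving A (∁ (triple x y z))
      complement-not-resolving {x} {y} {z} x≢y x≢z y≢z res =
        -- Truncated subtraction gives `n ∸ 3 < n ∸ 2` because `3 ≤ n`.
        ℕ.<⇒≱ (ℕ.∸-monoʳ-< {n} {3} {2} ℕ.≤-refl (ℕ.≤-trans (ℕ.n≤1+n 3) 4≤n))
          (subst (n ∸ 2 ≤_) (trans (Subset.∣∁p∣≡n∸∣p∣ (triple x y z)) (cong (n ∸_) (∣triple∣ x≢y x≢z y≢z)))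
            (minimal _ res))

      -- If each pair in the triple were separated from outside it, the `n ∸ 3` remaining vertices
      -- would be weakly resolving, against minimality.
      dtwin-triples : ∀ x y z → x ≢ y → x ≢ z → y ≢ z → DTwins z x y ⊎ DTwins y x z ⊎ DTwins x y z
      dtwin-triples x y z x≢y x≢z y≢z
        with separated? z x y | separated? y x z | separated? x y z
      ... | no ¬s | _ | _ = inj₁ (unseparated⇒dtwins ¬s)
      ... | yes _ | no ¬s | _ = inj₂ (inj₁ (unseparated⇒dtwins ¬s))
      ... | yes _ | yes _ | no ¬s = inj₂ (inj₂ (unseparated⇒dtwins ¬s))
      ... | yes (p , p≢x , p≢y , p≢z , p-sep) | yes (q , q≢x , q≢z , q≢y , q-sep) | yes (r , r≢y , r≢z , r≢x , r-sep) =
        contradiction (resolving W λ u v u≢v u∉ v∉ →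
            pairs u≢v (∈-triple⁻ (Subset.x∉∁p⇒x∈p u∉)) (∈-triple⁻ (Subset.x∉∁p⇒x∈p v∉)))
          (complement-not-resolving x≢y x≢z y≢z)
        where
        W = ∁ (triple x y z)
        in-W : ∀ {w} → w ≢ x → w ≢ y → w ≢ z → w ∈ W
        in-W a b c = Subset.x∉p⇒x∈∁p (∉-triple⁺ a b c)
        pairs : ∀ {u v} → u ≢ v → u ≡ x ⊎ u ≡ y ⊎ u ≡ z → v ≡ x ⊎ v ≡ y ⊎ v ≡ z → ∃[ w ] (w ∈ W × δ w u ≢ δ w v)
        pairs u≢v (inj₁ refl) (inj₁ refl) = contradiction refl u≢v
        pairs u≢v (inj₁ refl) (inj₂ (inj₁ refl)) = p , in-W p≢x p≢y p≢z , p-sep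
        pairs u≢v (inj₁ refl) (inj₂ (inj₂ refl)) = q , in-W q≢x q≢y q≢z , q-sep
        pairs u≢v (inj₂ (inj₁ refl)) (inj₁ refl) = p , in-W p≢x p≢y p≢z , ≢-sym p-sep
        pairs u≢v (inj₂ (inj₁ refl)) (inj₂ (inj₁ refl)) = contradiction refl u≢v
        pairs u≢v (inj₂ (inj₁ refl)) (inj₂ (inj₂ refl)) = r , in-W r≢x r≢y r≢z , r-sep
        pairs u≢v (inj₂ (inj₂ refl)) (inj₁ refl) = q , in-W q≢x q≢y q≢z , ≢-sym q-sep
        pairs u≢v (inj₂ (inj₂ refl)) (inj₂ (inj₁ refl)) = r , in-W r≢x r≢y r≢z , ≢-sym r-sep
        pairs u≢v (inj₂ (inj₂ refl)) (inj₂ (inj₂ refl)) = contradiction refl u≢v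

      -- The first three vertices of a geodesic of length at least 3 are at pairwise distinct
      -- distances from its endpoint, so they contain no pair of twins.
      no-long-geodesic : ∀ {x a b y k} → IsDist A x y (3 + k) → IsDist A a y (2 + k) → ¬ IsDist A b y (1 + k)
      no-long-geodesic {x} {a} {b} {y} {k} p q r with dtwin-triples x a b
          (λ { refl → apart (λ ()) (isDist-unique p q) })
          (λ { refl → apart (λ ()) (isDist-unique p r) })
          (λ { refl → apart (λ ()) (isDist-unique q r) })
        where
        apart : ∀ {i j} → i ≢ j → i + k ≢ j + k
        apart i≢j = i≢j ∘ ℕ.+-cancelʳ-≡ k _ _
      ... | t = clash t
        where
        y≢ : ∀ {u i} → IsDist A u y (suc i) → y ≢ u
        y≢ s refl = contradiction (isDist-unique s isDist-refl) λ ()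
        d≢ : ∀ {u v i j} → IsDist A u y (i + k) → IsDist A v y (j + k) → i ≢ j → δ y u ≢ δ y v
        d≢ {u} {v} s t i≢j eq = i≢j (ℕ.+-cancelʳ-≡ k _ _ (trans (isDist-unique s (isDist-d u y))
          (trans (cong proj₂ eq) (isDist-unique (isDist-d v y) t))))
        clash : ¬ (DTwins b x a ⊎ DTwins a x b ⊎ DTwins x a b)
        clash (inj₁ t) = d≢ {i = 3} {2} p q (λ ()) (t y (y≢ p) (y≢ q) (y≢ r))
        clash (inj₂ (inj₁ t)) = d≢ {i = 3} {1} p r (λ ()) (t y (y≢ p) (y≢ r) (y≢ q))
        clash (inj₂ (inj₂ t)) = d≢ {i = 2} {1} q r (λ ()) (t y (y≢ q) (y≢ r) (y≢ p))

      geodesic-tail : ∀ {x y z k} → A x y ≡ true → Walk A y z k → (∀ i → i < suc k → ¬ Walk A x z i) → IsDist A y z k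
      geodesic-tail a p shortest = p , λ i i<k q → shortest (suc i) (s≤s i<k) (cons a q)

      -- A shortest walk with at least three arcs, together with its tails after one and after two
      -- arcs, is what `no-long-geodesic` excludes.
      diameter : Diameter≤2 A
      diameter x y x≢y with distance connected x y
      ... | _ , nil , _ = contradiction refl x≢y
      ... | _ , cons a nil , _ = inj₁ a
      ... | _ , cons a (cons b nil) , _ = inj₂ (_ , a , b)
      ... | _ , cons a (cons b (cons c p)) , min =
        contradiction (geodesic-tail b (cons c p) (proj₂ tail)) (no-long-geodesic (cons a (cons b (cons c p)) , min) tail)
        where
        tail = geodesic-tail a (cons b (cons c p)) min

      twin-triples : TwinTriples A
      twin-triples x y z x≢y x≢z y≢z =
        ⊎-map dtwins⇒twins (⊎-map dtwins⇒twins dtwins⇒twins) (dtwin-triples x y z x≢y x≢z y≢z)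

  dim⇒twin-triples : 4 ≤ n → HasDim A (n ∸ 2) → TwinTriples A × Diameter≤2 A
  dim⇒twin-triples 4≤n (_ , minimal) = twin-triples 4≤n minimal , diameter 4≤n minimal

  -- For the upper bound take a detour `b → c → a`: since `c → a` but not `b → a`, the vertex `a`
  -- separates `b` from `c`, and the complement of these two resolves. For the lower bound, a
  -- smaller set misses three vertices, and two of them are twins up to the third.
  twin-triples⇒dim : Loopless A → ∀ {a b} → A a b ≡ true → A b a ≡ false →
    TwinTriples A → Diameter≤2 A → HasDim A (n ∸ 2)
  twin-triples⇒dim loopless {a} {b} a→b b↛a triples diam = (∁ (pair b c) , resolves , size) , minimal
    where
    b≢a : b ≢ a
    b≢a = ≢-sym (arc⇒≢ {A = A} loopless a→b)

    detour : ∃[ c ] (A b c ≡ true × A c a ≡ true)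
    detour with diam b a b≢a
    ... | inj₁ b→a = contradiction (trans (sym b→a) b↛a) true≢false
    ... | inj₂ path = path
    c = proj₁ detour

    b≢c : b ≢ c
    b≢c = arc⇒≢ {A = A} loopless (proj₁ (proj₂ detour))

    size : ∣ ∁ (pair b c) ∣ ≡ n ∸ 2
    size = trans (Subset.∣∁p∣≡n∸∣p∣ (pair b c)) (cong (n ∸_) (∣pair∣ b≢c))

    c≢a : c ≢ a
    c≢a = arc⇒≢ {A = A} loopless (proj₂ (proj₂ detour))

    a-separates : δ a b ≢ δ a c
    a-separates eq = true≢false (trans (sym (isDist-one (subst (IsDist A b a)
      (trans (cong proj₂ eq) (isDist-unique (isDist-d c a) (isDist-arc c≢a (proj₂ (proj₂ detour)))))
      (isDist-d b a)))) b↛a)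

    a∈ : a ∈ ∁ (pair b c)
    a∈ = Subset.x∉p⇒x∈∁p ([ ≢-sym b≢a , ≢-sym c≢a ]′ ∘ ∈-pair⁻)

    resolves : WeaklyResolving A (∁ (pair b c))
    resolves = resolving _ λ u v u≢v u∉ v∉ →
      pairs u≢v (∈-pair⁻ (Subset.x∉∁p⇒x∈p u∉)) (∈-pair⁻ (Subset.x∉∁p⇒x∈p v∉))
      where
      pairs : ∀ {u v} → u ≢ v → u ≡ b ⊎ u ≡ c → v ≡ b ⊎ v ≡ c → ∃[ w ] (w ∈ ∁ (pair b c) × δ w u ≢ δ w v)
      pairs u≢v (inj₁ refl) (inj₁ refl) = contradiction refl u≢v
      pairs u≢v (inj₁ refl) (inj₂ refl) = a , a∈ , a-separates
      pairs u≢v (inj₂ refl) (inj₁ refl) = a , a∈ , ≢-sym a-separates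
      pairs u≢v (inj₂ refl) (inj₂ refl) = contradiction refl u≢v

    -- Every member of `W` differs from all of `x`, `y`, `z`, so the exempt vertex cannot resolve
    -- the pair, and equal types mean equal distances.
    twins-unresolved : ∀ W {x y z} → WeaklyResolving A W → x ≢ y → x ∉ W → y ∉ W → z ∉ W → ¬ Twins A z x y
    twins-unresolved W {x} {y} {z} res x≢y x∉ y∉ z∉ twins with res x y x≢y
    ... | w , w∈W , d₁ , d₂ , e₁ , e₂ , p₁ , p₂ , q₁ , q₂ , neq =
      neq (cong₂ _,_ (isDist-cong diam (avoid x∉) (avoid y∉) (cong proj₁ eq) p₁ p₂)
                     (isDist-cong diam (≢-sym (avoid x∉)) (≢-sym (avoid y∉)) (cong proj₂ eq) q₁ q₂))
      where
      avoid : ∀ {u} → u ∉ W → w ≢ u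
      avoid u∉ refl = u∉ w∈W
      eq = twins w (avoid x∉) (avoid y∉) (avoid z∉)

    minimal : ∀ W → WeaklyResolving A W → n ∸ 2 ≤ ∣ W ∣
    minimal W res with n ∸ 2 ≤? ∣ W ∣
    ... | yes le = le
    ... | no nle with three-outsiders W (ℕ.≰⇒> (nle ∘ ℕ.m≤n+o⇒m∸n≤o n 2))
    ... | x , y , z , x≢y , x≢z , y≢z , x∉ , y∉ , z∉ with triples x y z x≢y x≢z y≢z
    ... | inj₁ t = contradiction t (twins-unresolved W res x≢y x∉ y∉ z∉)
    ... | inj₂ (inj₁ t) = contradiction t (twins-unresolved W res x≢z x∉ z∉ y∉)
    ... | inj₂ (inj₂ t) = contradiction t (twins-unresolved W res y≢z y∉ z∉ x∉)

-- Blow-ups of small digraphs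

-- The diagonal entry of M at i says whether the fibre over i is complete or empty;
-- u marks the colours whose fibre is a single vertex.
record BlowUp (M : Digraph (Fin m)) (u : Fin m → Bool) (A : Digraph (Fin n)) : Set where
  field
    colour : Fin n → Fin m
    onto   : ∀ i → ∃[ x ] colour x ≡ i
    single : ∀ x y → colour x ≡ colour y → u (colour x) ≡ true → x ≡ y
    arcs   : ∀ x y → x ≢ y → A x y ≡ M (colour x) (colour y)

module _ (M : Digraph (Fin m)) (u : Fin m → Bool) where

  -- The colour form of `Twins`: colour `l` may see `i` and `j` differently only if its fibre is a
  -- single vertex belonging to the triple. Any larger fibre could contain a separating vertex
  -- outside the triple.
  Agree : Fin m → Fin m → Fin m → Set
  Agree k i j = ∀ l → (u l ≡ true × (l ≡ i ⊎ l ≡ j ⊎ l ≡ k)) ⊎ τ M l i ≡ τ M l j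

  ColourTriples : Set
  ColourTriples = ∀ i j k → i ≢ j → i ≢ k → j ≢ k → Agree k i j ⊎ Agree j i k ⊎ Agree i j k

  -- The first alternative covers a fibre with no two distinct vertices. Requiring `l` to differ
  -- from `i` and `j` keeps the middle vertex of a detour distinct from its ends.
  ColourDiameter≤2 : Set
  ColourDiameter≤2 = ∀ i j →
    (i ≡ j × u i ≡ true) ⊎ M i j ≡ true ⊎ ∃[ l ] (l ≢ i × l ≢ j × M i l ≡ true × M l j ≡ true)

  private
    agree? : ∀ k i j → Dec (Agree k i j)
    agree? k i j = all? λ l →
      ((u l Bool.≟ true) ×-dec (l ≟ i ⊎-dec l ≟ j ⊎-dec l ≟ k)) ⊎-dec ≡-dec Bool._≟_ Bool._≟_ (τ M l i) (τ M l j)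

  colourTriples? : Dec ColourTriples
  colourTriples? = all? λ i → all? λ j → all? λ k →
    ¬? (i ≟ j) →-dec ¬? (i ≟ k) →-dec ¬? (j ≟ k) →-dec (agree? k i j ⊎-dec agree? j i k ⊎-dec agree? i j k)

  colourDiameter≤2? : Dec ColourDiameter≤2
  colourDiameter≤2? = all? λ i → all? λ j →
    ((i ≟ j) ×-dec (u i Bool.≟ true)) ⊎-dec (M i j Bool.≟ true) ⊎-dec
    any? λ l → ¬? (l ≟ i) ×-dec ¬? (l ≟ j) ×-dec (M i l Bool.≟ true) ×-dec (M l j Bool.≟ true)

  Good : Set
  Good = ColourTriples × ColourDiameter≤2

  good? : Dec Good
  good? = colourTriples? ×-dec colourDiameter≤2?

module _ {M : Digraph (Fin m)} {u : Fin m → Bool} {A : Digraph (Fin n)} (blowUp : BlowUp M u A) where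
  open BlowUp blowUp

  private
    τ-colour : ∀ {w x} → w ≢ x → τ A w x ≡ τ M (colour w) (colour x)
    τ-colour w≢x = cong₂ _,_ (arcs _ _ w≢x) (arcs _ _ (≢-sym w≢x))

    same-colour : ∀ z {x y} → colour x ≡ colour y → Twins A z x y
    same-colour z eq w w≢x w≢y _ =
      trans (τ-colour w≢x) (trans (cong (τ M (colour w)) eq) (sym (τ-colour w≢y)))

    agree⇒twins : ∀ {z x y} → Agree M u (colour z) (colour x) (colour y) → Twins A z x y
    agree⇒twins agree w w≢x w≢y w≢z with agree (colour w)
    ... | inj₁ (one , inj₁ eq) = contradiction (single _ _ eq one) w≢x
    ... | inj₁ (one , inj₂ (inj₁ eq)) = contradiction (single _ _ eq one) w≢y
    ... | inj₁ (one , inj₂ (inj₂ eq)) = contradiction (single _ _ eq one) w≢z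
    ... | inj₂ eq = trans (τ-colour w≢x) (trans eq (sym (τ-colour w≢y)))

  blowUp-twin-triples : ColourTriples M u → TwinTriples A
  blowUp-twin-triples good x y z _ _ _
    with colour x ≟ colour y | colour x ≟ colour z | colour y ≟ colour z
  ... | yes xy | _ | _ = inj₁ (same-colour z xy)
  ... | no _ | yes xz | _ = inj₂ (inj₁ (same-colour y xz))
  ... | no _ | no _ | yes yz = inj₂ (inj₂ (same-colour x yz))
  ... | no xy | no xz | no yz =
    ⊎-map agree⇒twins (⊎-map agree⇒twins agree⇒twins) (good _ _ _ xy xz yz)

  blowUp-diameter : ColourDiameter≤2 M u → Diameter≤2 A
  blowUp-diameter good x y x≢y with good (colour x) (colour y)
  ... | inj₁ (eq , one) = contradiction (single x y eq one) x≢y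
  ... | inj₂ (inj₁ arc) = inj₁ (trans (arcs x y x≢y) arc)
  ... | inj₂ (inj₂ (l , l≢x , l≢y , a , b)) with onto l
  ... | z , refl = inj₂ (z , trans (arcs x z (λ { refl → l≢x refl })) a , trans (arcs z y (λ { refl → l≢y refl })) b)

  -- The involution `π` renames colours so that the reverse of `M` becomes `M′`; being its own
  -- inverse, it also gives surjectivity of the new colouring.
  blowUp-reverse : {M′ : Digraph (Fin m)} {u′ : Fin m → Bool} (π : Fin m → Fin m) →
    (∀ i → π (π i) ≡ i) → (∀ i → u′ (π i) ≡ u i) → (∀ i j → M′ (π i) (π j) ≡ M j i) →
    BlowUp M′ u′ (flip A)
  blowUp-reverse π involutive π-u π-M = record
    { colour = π ∘ colour
    ; onto   = λ i → proj₁ (onto (π i)) , trans (cong π (proj₂ (onto (π i)))) (involutive i)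
    ; single = λ x y eq one → single x y
        (trans (sym (involutive _)) (trans (cong π eq) (involutive _))) (trans (sym (π-u _)) one)
    ; arcs   = λ x y x≢y → trans (arcs y x (≢-sym x≢y)) (sym (π-M _ _))
    }

-- Inside a fibre a lexicographic product consults the factor and not `G`, so the diagonal is free
-- to record which fibres are complete.
fill : Digraph (Fin m) → (Fin m → Bool) → Digraph (Fin m)
fill G d i j with i ≟ j
... | yes _ = d i
... | no _ = G i j

module _ (G : Digraph (Fin m)) (s : Fin m → ℕ) (H : ∀ i → Digraph (Fin (s i))) where

  Lex-diagonal : ∀ i x y → Lex G s H (i , x) (i , y) ≡ H i x y
  Lex-diagonal i x y with i ≟ i
  ... | yes refl = refl
  ... | no i≢i = contradiction refl i≢i

  Lex-fill : (d : Fin m → Bool) → (∀ i x y → x ≢ y → H i x y ≡ d i) →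
    ∀ p q → p ≢ q → Lex G s H p q ≡ fill G d (proj₁ p) (proj₁ q)
  Lex-fill d uniform (i , x) (j , y) p≢q with i ≟ j
  ... | yes refl = uniform i x y λ { refl → p≢q refl }
  ... | no _ = refl

  iso⇒blowUp : {A : Digraph (Fin n)} (d u : Fin m → Bool) → (∀ i x y → x ≢ y → H i x y ≡ d i) →
    (∀ i → Fin (s i)) → (∀ i → u i ≡ true → s i ≡ 1) → Iso A (Lex G s H) → BlowUp (fill G d) u A
  iso⇒blowUp d u uniform inhabited small (f , f-arcs) = record
    { colour = proj₁ ∘ to
    ; onto   = λ i → from (i , inhabited i) , cong proj₁ (strictlyInverseˡ (i , inhabited i))
    ; single = λ x y eq one → to-injective (unique (to x) (to y) eq (small _ one))
    ; arcs   = λ x y x≢y → trans (f-arcs x y) (Lex-fill d uniform (to x) (to y) (x≢y ∘ to-injective))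
    }
    where
    open Inverse f
    to-injective : ∀ {x y} → to x ≡ to y → x ≡ y
    to-injective {x} {y} eq = trans (sym (strictlyInverseʳ x)) (trans (cong from eq) (strictlyInverseʳ y))

    Fin1-unique : ∀ {k} → k ≡ 1 → (a b : Fin k) → a ≡ b
    Fin1-unique refl 0F 0F = refl

    unique : ∀ (p q : Σ (Fin m) (Fin ∘ s)) → proj₁ p ≡ proj₁ q → s (proj₁ p) ≡ 1 → p ≡ q
    unique (i , a) (i , b) refl one = cong (i ,_) (Fin1-unique one a b)

-- Numbering the vertices of each colour.

bump : {P : Set} → Dec P → ℕ → ℕ
bump (yes _) k = suc k
bump (no _) k = k

-- The decision is handed to `bump` so that a `with` on `c zero ≟ i` in `select` and `rank` also
-- reduces the type `Fin (count c i)`.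
count : (Fin n → Fin m) → Fin m → ℕ
count {zero} c i = 0
count {suc n} c i = bump (c zero ≟ i) (count (c ∘ suc) i)

select : (c : Fin n → Fin m) (i : Fin m) → Fin (count c i) → Fin n
select {suc n} c i k with c zero ≟ i
select {suc n} c i zero    | yes _ = zero
select {suc n} c i (suc k) | yes _ = suc (select (c ∘ suc) i k)
select {suc n} c i k       | no _ = suc (select (c ∘ suc) i k)

colour-select : (c : Fin n → Fin m) (i : Fin m) (k : Fin (count c i)) → c (select c i k) ≡ i
colour-select {suc n} c i k with c zero ≟ i
colour-select {suc n} c i zero    | yes eq = eq
colour-select {suc n} c i (suc k) | yes _ = colour-select (c ∘ suc) i k
colour-select {suc n} c i k       | no _ = colour-select (c ∘ suc) i k

rank : (c : Fin n → Fin m) (i : Fin m) (x : Fin n) → c x ≡ i → Fin (count c i)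
rank {suc n} c i x eq with c zero ≟ i
rank {suc n} c i zero    eq | yes _ = zero
rank {suc n} c i (suc x) eq | yes _ = suc (rank (c ∘ suc) i x eq)
rank {suc n} c i zero    eq | no neq = contradiction eq neq
rank {suc n} c i (suc x) eq | no _ = rank (c ∘ suc) i x eq

select-rank : (c : Fin n → Fin m) (i : Fin m) (x : Fin n) (eq : c x ≡ i) → select c i (rank c i x eq) ≡ x
select-rank {suc n} c i x eq with c zero ≟ i
select-rank {suc n} c i zero    eq | yes _ = refl
select-rank {suc n} c i (suc x) eq | yes _ = cong suc (select-rank (c ∘ suc) i x eq)
select-rank {suc n} c i zero    eq | no neq = contradiction eq neq
select-rank {suc n} c i (suc x) eq | no _ = cong suc (select-rank (c ∘ suc) i x eq)

rank-select : (c : Fin n → Fin m) (i : Fin m) (k : Fin (count c i)) (eq : c (select c i k) ≡ i) →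
  rank c i (select c i k) eq ≡ k
rank-select {suc n} c i k eq with c zero ≟ i
rank-select {suc n} c i zero    eq | yes _ = refl
rank-select {suc n} c i (suc k) eq | yes _ = cong suc (rank-select (c ∘ suc) i k eq)
rank-select {suc n} c i k       eq | no _ = rank-select (c ∘ suc) i k eq

count-total : (c : Fin n → Fin 3) → count c 0F + count c 1F + count c 2F ≡ n
count-total {zero} c = refl
count-total {suc n} c with c zero | count-total (c ∘ suc)
... | 0F | ih = cong suc ih
... | 1F | ih = trans (cong (_+ count (c ∘ suc) 2F) (ℕ.+-suc _ _)) (cong suc ih)
... | 2F | ih = trans (ℕ.+-suc _ _) (cong suc ih)

count-single : (c : Fin n → Fin m) (i : Fin m) → ∃[ x ] c x ≡ i →
  (∀ x y → c x ≡ c y → c x ≡ i → x ≡ y) → count c i ≡ 1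
count-single c i (x , cx≡i) single = one (rank c i x cx≡i) λ k l →
    trans (sym (rank-select c i k (colour-select c i k)))
      (trans (rank-cong (single _ _ (trans (colour-select c i k) (sym (colour-select c i l))) (colour-select c i k)))
        (rank-select c i l (colour-select c i l)))
  where
  one : ∀ {k} → Fin k → (∀ (a b : Fin k) → a ≡ b) → k ≡ 1
  one {suc zero} _ _ = refl
  one {suc (suc _)} _ all≡ = contradiction (all≡ 0F 1F) λ ()

  rank-cong : ∀ {x y} {p : c x ≡ i} {q : c y ≡ i} → x ≡ y → rank c i x p ≡ rank c i y q
  rank-cong {x} {p = refl} {q = refl} refl = refl

count-positive : (c : Fin n → Fin m) (i : Fin m) → ∃[ x ] c x ≡ i → 1 ≤ count c i
count-positive c i (x , eq) with count c i | rank c i x eq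
... | suc _ | _ = s≤s z≤n

-- A vertex is sent to its colour and its rank within that colour, so only the fibre sizes have to
-- match.
blowUp⇒iso : (G : Digraph (Fin m)) (s : Fin m → ℕ) (H : ∀ i → Digraph (Fin (s i))) {d u : Fin m → Bool}
  {A : Digraph (Fin n)} → Loopless A → (∀ i x y → x ≢ y → H i x y ≡ d i) → (∀ i → Loopless (H i)) →
  (blowUp : BlowUp (fill G d) u A) → (∀ i → count (BlowUp.colour blowUp) i ≡ s i) → Iso A (Lex G s H)
blowUp⇒iso {m = m} {n} G s H {d} {A = A} A-loopless uniform H-loopless blowUp sizes =
  mk↔ₛ′ to from to∘from from∘to , preserves
  where
  open BlowUp blowUp

  to : Fin n → Σ (Fin m) (Fin ∘ s)
  to x = colour x , cast (sizes _) (rank colour _ x refl)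

  from : Σ (Fin m) (Fin ∘ s) → Fin n
  from (i , k) = select colour i (cast (sym (sizes i)) k)

  from∘to : ∀ x → from (to x) ≡ x
  from∘to x = trans (cong (select colour (colour x)) (cast-involutive (sym (sizes _)) (sizes _) _)) (select-rank colour _ x refl)

  to-at : ∀ i x (eq : colour x ≡ i) → to x ≡ (i , cast (sizes i) (rank colour i x eq))
  to-at _ x refl = refl

  to∘from : ∀ p → to (from p) ≡ p
  to∘from (i , k) = trans (to-at i _ (colour-select colour i _))
    (cong (i ,_) (trans (cong (cast (sizes i)) (rank-select colour i _ _)) (cast-involutive (sizes i) (sym (sizes i)) k)))

  preserves : ∀ x y → A x y ≡ Lex G s H (to x) (to y)
  preserves x y with x ≟ y
  ... | yes refl = trans (A-loopless x) (sym (trans (Lex-diagonal G s H (colour x) _ _) (H-loopless _ _)))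
  ... | no x≢y = trans (arcs x y x≢y) (sym (Lex-fill G s H d uniform (to x) (to y)
        λ eq → x≢y (trans (sym (from∘to x)) (trans (cong from eq) (from∘to y)))))

-- The extremal digraphs as blow-ups

module _ {t : ℕ} where
  K-apart : (x y : Fin t) → x ≢ y → K t x y ≡ true
  K-apart x y x≢y with x ≟ y
  ... | yes x≡y = contradiction x≡y x≢y
  ... | no _ = refl

  K-loopless : Loopless (K t)
  K-loopless x with x ≟ x
  ... | yes _ = refl
  ... | no x≢x = contradiction refl x≢x

everywhere only0 only2 only02 : Fin 3 → Bool
everywhere _ = true
only0 0F = true
only0 _ = false
only2 2F = true
only2 _ = false
only02 1F = false
only02 _ = true

K-uniform : ∀ {a b c} i x y → x ≢ y → comp3 (K a) (K b) (K c) i x y ≡ true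
K-uniform 0F = K-apart
K-uniform 1F = K-apart
K-uniform 2F = K-apart

comp3-loopless : ∀ {a b c} {H₀ : Digraph (Fin a)} {H₁ : Digraph (Fin b)} {H₂ : Digraph (Fin c)} →
  Loopless H₀ → Loopless H₁ → Loopless H₂ → ∀ i → Loopless (comp3 H₀ H₁ H₂ i)
comp3-loopless l₀ l₁ l₂ 0F = l₀
comp3-loopless l₀ l₁ l₂ 1F = l₁
comp3-loopless l₀ l₁ l₂ 2F = l₂

Kbar-uniform : ∀ {b} i x y → x ≢ y → comp3 (K 1) (Kbar b) (K 1) i x y ≡ only02 i
Kbar-uniform 0F = K-apart
Kbar-uniform 1F = λ _ _ _ → refl
Kbar-uniform 2F = K-apart

-- `P2` is neither complete nor empty, so its fibre is split into two colours of one vertex each,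
-- which makes four in all.
vertex4 : Fin 4 → Σ (Fin 3) (Fin ∘ size3 1 2 1)
vertex4 0F = 0F , 0F
vertex4 1F = 1F , 0F
vertex4 2F = 1F , 1F
vertex4 3F = 2F , 0F

index4 : Σ (Fin 3) (Fin ∘ size3 1 2 1) → Fin 4
index4 (0F , 0F) = 0F
index4 (1F , 0F) = 1F
index4 (1F , 1F) = 2F
index4 (2F , 0F) = 3F

vertex4-index4 : ∀ p → vertex4 (index4 p) ≡ p
vertex4-index4 (0F , 0F) = refl
vertex4-index4 (1F , 0F) = refl
vertex4-index4 (1F , 1F) = refl
vertex4-index4 (2F , 0F) = refl

index4-vertex4 : ∀ i → index4 (vertex4 i) ≡ i
index4-vertex4 0F = refl
index4-vertex4 1F = refl
index4-vertex4 2F = refl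
index4-vertex4 3F = refl

G2[K1,P2,K1] : Digraph (Fin 4)
G2[K1,P2,K1] i j = Lex3 G2 (K 1) P2 (K 1) (vertex4 i) (vertex4 j)

-- The five families without their size parameter; `t` is recovered by counting a fibre.
data Shape (A : Digraph (Fin n)) : Set where
  G1-K1-K-K    : BlowUp (fill G1 everywhere) only0 A → Shape A
  G2-K1-K-K    : BlowUp (fill G2 everywhere) only0 A → Shape A
  G2-K-K-K1    : BlowUp (fill G2 everywhere) only2 A → Shape A
  G2-K1-Kbar-K1 : BlowUp (fill G2 only02) only02 A → Shape A
  G2-K1-P2-K1  : BlowUp G2[K1,P2,K1] (λ _ → true) A → Shape A

-- The implicit `True` argument is solved by evaluating `good?` on a concrete `M`, which carries out
-- the finite check on colours.
blowUp⇒twin-triples : {M : Digraph (Fin m)} {u : Fin m → Bool} {A : Digraph (Fin n)} {_ : True (good? M u)} →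
  BlowUp M u A → TwinTriples A × Diameter≤2 A
blowUp⇒twin-triples {M = M} {u} {_} {good} blowUp =
  blowUp-twin-triples blowUp (proj₁ (toWitness good)) , blowUp-diameter blowUp (proj₂ (toWitness good))

shape⇒twin-triples : {A : Digraph (Fin n)} → Shape A → TwinTriples A × Diameter≤2 A
shape⇒twin-triples (G1-K1-K-K b) = blowUp⇒twin-triples b
shape⇒twin-triples (G2-K1-K-K b) = blowUp⇒twin-triples b
shape⇒twin-triples (G2-K-K-K1 b) = blowUp⇒twin-triples b
shape⇒twin-triples (G2-K1-Kbar-K1 b) = blowUp⇒twin-triples b
shape⇒twin-triples (G2-K1-P2-K1 b) = blowUp⇒twin-triples b

extremal⇒shape : {A : Digraph (Fin n)} → 4 ≤ n → Extremal n A → Shape A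
extremal⇒shape {n} {A} _ (inj₁ (f , f-arcs)) = G2-K1-P2-K1 record
  { colour = index4 ∘ to
  ; onto   = λ i → from (vertex4 i) , trans (cong index4 (strictlyInverseˡ _)) (index4-vertex4 i)
  ; single = λ x y eq _ → trans (sym (strictlyInverseʳ x)) (trans (cong from (index4-injective eq)) (strictlyInverseʳ y))
  ; arcs   = λ x y _ → trans (f-arcs x y)
      (sym (cong₂ (Lex3 G2 (K 1) P2 (K 1)) (vertex4-index4 (to x)) (vertex4-index4 (to y))))
  }
  where
  open Inverse f
  index4-injective : ∀ {p q} → index4 p ≡ index4 q → p ≡ q
  index4-injective {p} {q} eq = trans (sym (vertex4-index4 p)) (trans (cong vertex4 eq) (vertex4-index4 q))
extremal⇒shape {n} 4≤n (inj₂ (inj₁ (t , 1≤t , t≤n-2 , isos))) = shape isos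
  where
  fin : ∀ {k} → 1 ≤ k → Fin k
  fin (s≤s _) = zero

  rest : Fin (n ∸ t ∸ 1)
  -- From `t ≤ n ∸ 2` follows `t + 1 ≤ n ∸ 2 + 1 < n`, so this fibre is not empty.
  rest = fin (subst (1 ≤_) (sym (ℕ.∸-+-assoc n t 1))
    (ℕ.m<n⇒0<n∸m (ℕ.≤-<-trans (ℕ.+-monoˡ-≤ 1 t≤n-2)
      (subst (n ∸ 2 + 1 <_) (ℕ.m∸n+n≡m (ℕ.≤-trans (s≤s (s≤s z≤n)) 4≤n)) (ℕ.+-monoʳ-< (n ∸ 2) (ℕ.n<1+n 1))))))

  shape : _ → Shape _
  shape (inj₁ iso) = G1-K1-K-K (iso⇒blowUp G1 _ _ everywhere only0 K-uniform
    (λ { 0F → zero ; 1F → fin 1≤t ; 2F → rest }) (λ { 0F _ → refl }) iso)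
  shape (inj₂ (inj₁ iso)) = G2-K1-K-K (iso⇒blowUp G2 _ _ everywhere only0 K-uniform
    (λ { 0F → zero ; 1F → fin 1≤t ; 2F → rest }) (λ { 0F _ → refl }) iso)
  shape (inj₂ (inj₂ iso)) = G2-K-K-K1 (iso⇒blowUp G2 _ _ everywhere only2 K-uniform
    (λ { 0F → fin 1≤t ; 1F → rest ; 2F → zero }) (λ { 2F _ → refl }) iso)
extremal⇒shape 4≤n (inj₂ (inj₂ iso)) = G2-K1-Kbar-K1 (iso⇒blowUp G2 _ _ only02 only02 Kbar-uniform
  (λ { 0F → zero ; 1F → middle 4≤n ; 2F → zero }) (λ { 0F _ → refl ; 2F _ → refl }) iso)
  where
  middle : ∀ {n} → 4 ≤ n → Fin (n ∸ 2)
  middle (s≤s (s≤s (s≤s _))) = zero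

n∸t∸1≡s : ∀ t s {n} → suc (t + s) ≡ n → n ∸ t ∸ 1 ≡ s
n∸t∸1≡s t s refl = cong (_∸ 1) (trans (cong (_∸ t) (sym (ℕ.+-suc t s))) (ℕ.m+n∸m≡n t (suc s)))

t≤n∸2 : ∀ t s {n} → suc (t + s) ≡ n → 1 ≤ s → t ≤ n ∸ 2
t≤n∸2 t (suc s) refl _ = subst (λ k → t ≤ k ∸ 1) (sym (ℕ.+-suc t s)) (ℕ.m≤m+n t s)

-- In the families with a parameter, `t` is the size of the first fibre not marked as single; the
-- total `n` then forces the size of the other one.
shape⇒extremal : {A : Digraph (Fin n)} → Loopless A → Shape A → Extremal n A
shape⇒extremal {n} {A} loopless = extremal
  where
  module _ {M : Digraph (Fin 3)} {u : Fin 3 → Bool} (blowUp : BlowUp M u A) where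
    open BlowUp blowUp

    size : Fin 3 → ℕ
    size = count colour

    size-single : ∀ i → u i ≡ true → size i ≡ 1
    size-single i one = count-single colour i (onto i) λ { x y eq refl → single x y eq one }

    size-positive : ∀ i → 1 ≤ size i
    size-positive i = count-positive colour i (onto i)

    first-single : u 0F ≡ true → suc (size 1F + size 2F) ≡ n
    first-single one = trans (cong (λ k → k + size 1F + size 2F) (sym (size-single 0F one))) (count-total colour)

    last-single : u 2F ≡ true → suc (size 0F + size 1F) ≡ n
    last-single one = trans (ℕ.+-comm 1 _)
      (trans (cong (λ k → size 0F + size 1F + k) (sym (size-single 2F one))) (count-total colour))

  extremal : Shape A → Extremal n A
  extremal (G1-K1-K-K b) = inj₂ (inj₁ (size b 1F , size-positive b 1F , t≤n∸2 _ _ (first-single b refl) (size-positive b 2F) ,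
    inj₁ (blowUp⇒iso G1 _ _ loopless K-uniform (comp3-loopless K-loopless K-loopless K-loopless) b
      λ { 0F → size-single b 0F refl ; 1F → refl ; 2F → sym (n∸t∸1≡s _ _ (first-single b refl)) })))
  extremal (G2-K1-K-K b) = inj₂ (inj₁ (size b 1F , size-positive b 1F , t≤n∸2 _ _ (first-single b refl) (size-positive b 2F) ,
    inj₂ (inj₁ (blowUp⇒iso G2 _ _ loopless K-uniform (comp3-loopless K-loopless K-loopless K-loopless) b
      λ { 0F → size-single b 0F refl ; 1F → refl ; 2F → sym (n∸t∸1≡s _ _ (first-single b refl)) }))))
  extremal (G2-K-K-K1 b) = inj₂ (inj₁ (size b 0F , size-positive b 0F , t≤n∸2 _ _ (last-single b refl) (size-positive b 1F) ,
    inj₂ (inj₂ (blowUp⇒iso G2 _ _ loopless K-uniform (comp3-loopless K-loopless K-loopless K-loopless) b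
      λ { 0F → refl ; 1F → sym (n∸t∸1≡s _ _ (last-single b refl)) ; 2F → size-single b 2F refl }))))
  extremal (G2-K1-Kbar-K1 b) = inj₂ (inj₂
    (blowUp⇒iso G2 _ _ loopless Kbar-uniform (comp3-loopless K-loopless (λ _ → refl) K-loopless) b
      λ { 0F → size-single b 0F refl ; 1F → middle ; 2F → size-single b 2F refl }))
    where
    middle : size b 1F ≡ n ∸ 2
    middle = cong (_∸ 2) (trans (cong suc (trans (ℕ.+-comm 1 (size b 1F))
      (cong (size b 1F +_) (sym (size-single b 2F refl))))) (first-single b refl))
  extremal (G2-K1-P2-K1 b) = inj₁ (mk↔ₛ′ (vertex4 ∘ colour) from to∘from from∘to , preserves)
    where
    open BlowUp b

    from : Σ (Fin 3) (Fin ∘ size3 1 2 1) → Fin n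
    from p = proj₁ (onto (index4 p))

    to∘from : ∀ p → vertex4 (colour (from p)) ≡ p
    to∘from p = trans (cong vertex4 (proj₂ (onto (index4 p)))) (vertex4-index4 p)

    from∘to : ∀ x → from (vertex4 (colour x)) ≡ x
    from∘to x = single _ _ (trans (proj₂ (onto _)) (index4-vertex4 (colour x))) refl

    no-loops : ∀ i → G2[K1,P2,K1] i i ≡ false
    no-loops 0F = refl
    no-loops 1F = refl
    no-loops 2F = refl
    no-loops 3F = refl

    preserves : ∀ x y → A x y ≡ Lex3 G2 (K 1) P2 (K 1) (vertex4 (colour x)) (vertex4 (colour y))
    preserves x y with x ≟ y
    ... | yes refl = trans (loopless x) (sym (no-loops (colour x)))
    ... | no x≢y = arcs x y x≢y

-- Classification

module Views {A : Digraph (Fin n)} (loopless : Loopless A) (triples : TwinTriples A) (diam : Diameter≤2 A) where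

  τ≢⇒≢ : ∀ {w x y} → τ A w x ≢ τ A w y → x ≢ y
  τ≢⇒≢ neq refl = neq refl

  -- In the triple `x`, `y`, `z` the vertex `w` separates `z` from both others, so `x` and `y` are
  -- the only pair left to be twins.
  split-twins : ∀ {w x y z} → w ≢ x → w ≢ y → w ≢ z → τ A w x ≢ τ A w z → τ A w y ≢ τ A w z → Twins A z x y
  split-twins {w} {x} {y} {z} w≢x w≢y w≢z xz yz with x ≟ y
  ... | yes refl = λ _ _ _ _ → refl
  ... | no x≢y with triples x y z x≢y (τ≢⇒≢ xz) (τ≢⇒≢ yz)
  ... | inj₁ t = t
  ... | inj₂ (inj₁ t) = contradiction (t w w≢x w≢z w≢y) xz
  ... | inj₂ (inj₂ t) = contradiction (t w w≢y w≢z w≢x) yz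

  -- Three vertices of different types at `w` would have all their pairs separated by `w`.
  two-types : ∀ {w x y} → w ≢ x → w ≢ y → τ A w x ≢ τ A w y → ∀ z → w ≢ z → τ A w z ≡ τ A w x ⊎ τ A w z ≡ τ A w y
  two-types {w} {x} {y} w≢x w≢y xy z w≢z with ≡-dec Bool._≟_ Bool._≟_ (τ A w x) (τ A w z)
  ... | yes eq = inj₁ (sym eq)
  ... | no xz with y ≟ z
  ... | yes refl = inj₂ refl
  ... | no y≢z with triples x y z (τ≢⇒≢ xy) (τ≢⇒≢ xz) y≢z
  ... | inj₁ t = contradiction (t w w≢x w≢y w≢z) xy
  ... | inj₂ (inj₁ t) = contradiction (t w w≢x w≢z w≢y) xz
  ... | inj₂ (inj₂ t) = inj₂ (sym (t w w≢y w≢z w≢x))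

  detour : ∀ {x y} → x ≢ y → A x y ≡ false → ∃[ m ] (A x m ≡ true × A m y ≡ true)
  detour {x} {y} x≢y x↛y with diam x y x≢y
  ... | inj₁ x→y = contradiction (trans (sym x→y) x↛y) true≢false
  ... | inj₂ path = path

  arc-≢ : ∀ {x y} → A x y ≡ true → x ≢ y
  arc-≢ = arc⇒≢ {A = A} loopless

  -- The arc bits of (x, y), (z, y), (z, x), (y, x) agree in turn: each step replaces one end by a
  -- twin, as seen from the other end.
  three-twins-symmetric : ∀ {x y z b} → x ≢ y → x ≢ z → y ≢ z → b ≢ x → b ≢ y → b ≢ z →
    Twins A b x y → Twins A b x z → Twins A b y z → A x y ≡ A y x
  three-twins-symmetric {x} {y} {z} x≢y x≢z y≢z b≢x b≢y b≢z xy xz yz =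
    trans (cong proj₂ (xz y (≢-sym x≢y) y≢z (≢-sym b≢y)))
      (trans (sym (cong proj₁ (xy z (≢-sym x≢z) (≢-sym y≢z) (≢-sym b≢z))))
        (sym (cong proj₂ (yz x x≢y x≢z (≢-sym b≢x)))))

  -- A vertex with two out-only neighbours.

  module Fan {w x₁ x₂ : Fin n} (x₁≢x₂ : x₁ ≢ x₂)
             (w-x₁ : τ A w x₁ ≡ (true , false)) (w-x₂ : τ A w x₂ ≡ (true , false)) where

    X : Fin n → Set
    X v = τ A w v ≡ (true , false)

    private
      -- Since `x₁` has no arc to `w`, its detour to `w` ends with an in-neighbour of `w`; this
      -- gives the second type at `w`.
      from-x₁ : ∃[ m ] (A x₁ m ≡ true × A m w ≡ true)
      from-x₁ = detour (≢-sym (arc-≢ (cong proj₁ w-x₁))) (cong proj₂ w-x₁)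
      y₀ = proj₁ from-x₁
      y₀→w = proj₂ (proj₂ from-x₁)

    -- This bit selects the family: `false` leads to `G1`, `true` to `G2`.
    back : Bool
    back = A w y₀

    Y : Fin n → Set
    Y v = τ A w v ≡ (back , true)

    Y-y₀ : Y y₀
    Y-y₀ = cong (back ,_) y₀→w

    X-≢ : ∀ {x} → X x → w ≢ x
    X-≢ xx = arc-≢ (cong proj₁ xx)

    Y-≢ : ∀ {y} → Y y → w ≢ y
    Y-≢ yy = ≢-sym (arc-≢ (cong proj₂ yy))

    X-Y : ∀ {x y} → X x → Y y → τ A w x ≢ τ A w y
    X-Y xx yy eq = true≢false (trans (sym (cong proj₂ yy)) (trans (sym (cong proj₂ eq)) (cong proj₂ xx)))

    XY-≢ : ∀ {x y} → X x → Y y → x ≢ y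
    XY-≢ xx yy = τ≢⇒≢ (X-Y xx yy)

    X⊎Y : ∀ v → w ≢ v → X v ⊎ Y v
    X⊎Y v w≢v with two-types (X-≢ w-x₁) (Y-≢ Y-y₀) (X-Y w-x₁ Y-y₀) v w≢v
    ... | inj₁ eq = inj₁ (trans eq w-x₁)
    ... | inj₂ eq = inj₂ (trans eq Y-y₀)

    X-twins : ∀ {x x′ y} → X x → X x′ → Y y → Twins A y x x′
    X-twins xx xx′ yy = split-twins (X-≢ xx) (X-≢ xx′) (Y-≢ yy) (X-Y xx yy) (X-Y xx′ yy)

    Y-twins : ∀ {y y′ x} → Y y → Y y′ → X x → Twins A x y y′
    Y-twins yy yy′ xx = split-twins (Y-≢ yy) (Y-≢ yy′) (X-≢ xx) (≢-sym (X-Y xx yy)) (≢-sym (X-Y xx yy′))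

    other-X : ∀ x → ∃[ x′ ] (X x′ × x ≢ x′)
    other-X x with x ≟ x₁
    ... | yes refl = x₂ , w-x₂ , x₁≢x₂
    ... | no x≢x₁ = x₁ , w-x₁ , x≢x₁

    X⊎Y-after : ∀ {x m} → X x → A x m ≡ true → X m ⊎ Y m
    X⊎Y-after xx x→m = X⊎Y _ λ { refl → true≢false (trans (sym x→m) (cong proj₂ xx)) }

    -- The detour from `x` to `w` passes through some `m` in `Y`. Taking a second member of `X` as
    -- the exempt vertex, `y` and `m` are twins as seen from `x`.
    X→Y : ∀ {x y} → X x → Y y → A x y ≡ true
    X→Y {x} {y} xx yy with detour (≢-sym (X-≢ xx)) (cong proj₂ xx) | other-X x
    ... | m , x→m , m→w | x′ , xx′ , x≢x′ with X⊎Y-after xx x→m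
    ... | inj₁ xm = contradiction (trans (sym m→w) (cong proj₂ xm)) true≢false
    ... | inj₂ ym = trans (cong proj₁ (Y-twins yy ym xx′ x (XY-≢ xx yy) (XY-≢ xx ym) x≢x′)) x→m

    X-symmetric : ∀ {x x′ x″} → X x → X x′ → X x″ → x ≢ x′ → x ≢ x″ → x′ ≢ x″ → A x x′ ≡ A x′ x
    X-symmetric a b c ab ac bc = three-twins-symmetric ab ac bc
      (≢-sym (XY-≢ a Y-y₀)) (≢-sym (XY-≢ b Y-y₀)) (≢-sym (XY-≢ c Y-y₀))
      (X-twins a b Y-y₀) (X-twins a c Y-y₀) (X-twins b c Y-y₀)

    X-sees-apart : ∀ {x y} → X x → Y y → τ A x y ≢ τ A x w
    X-sees-apart xx yy eq = true≢false (trans (sym (X→Y xx yy)) (trans (cong proj₁ eq) (cong proj₂ xx)))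

    X-sees : ∀ {x y} → X x → Y y → ∀ v → x ≢ v → τ A x v ≡ τ A x y ⊎ τ A x v ≡ τ A x w
    X-sees xx yy = two-types (XY-≢ xx yy) (≢-sym (X-≢ xx)) (X-sees-apart xx yy)

    private
      -- Otherwise x sees w and y in the two opposite one-way types, hence every other vertex of X
      -- one-way as well, and there is no detour for the missing direction.
      no-one-way : ∀ {x y} → X x → Y y → A y x ≢ false
      no-one-way {x} {y} xx yy y↛x with other-X x
      ... | x′ , xx′ , x≢x′ with X-sees xx yy x′ x≢x′
      ... | inj₁ eq with detour (≢-sym x≢x′) (trans (cong proj₂ eq) y↛x)
      ... | m , x′→m , m→x with X⊎Y-after xx′ x′→m
      ... | inj₁ xm = true≢false (trans (sym (trans (cong proj₁ eq) (X→Y xx yy))) (trans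
              (X-symmetric xx xx′ xm x≢x′ (≢-sym (arc-≢ m→x)) (arc-≢ x′→m)) (trans (cong proj₂ eq) y↛x)))
      ... | inj₂ ym with X-sees xx yy m (XY-≢ xx ym)
      ... | inj₁ eq′ = true≢false (trans (sym m→x) (trans (cong proj₂ eq′) y↛x))
      ... | inj₂ eq′ = X-sees-apart xx ym eq′
      no-one-way {x} {y} xx yy y↛x | x′ , xx′ , x≢x′ | inj₂ eq
        with detour x≢x′ (trans (cong proj₁ eq) (cong proj₂ xx))
      ... | m , x→m , m→x′ with X⊎Y-after xx x→m
      ... | inj₁ xm = true≢false (trans (sym (trans (cong proj₂ eq) (cong proj₁ xx))) (trans
              (sym (X-symmetric xx xx′ xm x≢x′ (arc-≢ x→m) (≢-sym (arc-≢ m→x′)))) (trans (cong proj₁ eq) (cong proj₂ xx))))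
      ... | inj₂ ym with X-sees xx′ ym x (≢-sym x≢x′)
      ... | inj₁ eq′ = true≢false (trans (sym m→x′) (trans (sym (cong proj₂ eq′)) (trans (cong proj₁ eq) (cong proj₂ xx))))
      ... | inj₂ eq′ = true≢false (trans (sym (trans (cong proj₂ eq) (cong proj₁ xx))) (trans (cong proj₁ eq′) (cong proj₂ xx′)))

    Y→X : ∀ {x y} → X x → Y y → A y x ≡ true
    Y→X xx yy = Bool.¬-not (no-one-way xx yy)

    -- The two types at `x′` are those of `y₀` and `w`, and both contain an arc into `x′`.
    X-complete : ∀ {x x′} → X x → X x′ → x ≢ x′ → A x x′ ≡ true
    X-complete {x} {x′} xx xx′ x≢x′ with X-sees xx′ Y-y₀ x (≢-sym x≢x′)
    ... | inj₁ eq = trans (cong proj₂ eq) (Y→X xx′ Y-y₀)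
    ... | inj₂ eq = trans (cong proj₂ eq) (cong proj₁ xx′)

    Y-complete : ∀ {y y′} → Y y → Y y′ → y ≢ y′ → A y y′ ≡ true
    Y-complete {y} {y′} yy yy′ y≢y′ with A w y Bool.≟ true
    -- Without the arc from `w`, the types of `x₁` and `w` at `y` differ, and both contain an arc
    -- out of `y`.
    ... | no w↛y with two-types {y} {x₁} {w} (≢-sym (XY-≢ w-x₁ yy)) (≢-sym (Y-≢ yy))
                        (λ eq → w↛y (trans (sym (cong proj₂ eq)) (X→Y w-x₁ yy))) y′ y≢y′
    ... | inj₁ eq = trans (cong proj₁ eq) (Y→X w-x₁ yy)
    ... | inj₂ eq = trans (cong proj₁ eq) (cong proj₂ yy)
    Y-complete {y} {y′} yy yy′ y≢y′ | yes _ = Bool.¬-not λ y↛y′ →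
      -- y would see w and x₁ alike but y′ differently, making w and x₁ twins from the viewpoint of x₂.
      true≢false (trans (sym (X-complete w-x₂ w-x₁ (≢-sym x₁≢x₂))) (trans
        (sym (cong proj₁ (split-twins {y} {w} {x₁} {y′} (≢-sym (Y-≢ yy)) (≢-sym (XY-≢ w-x₁ yy)) y≢y′
          (λ eq → true≢false (trans (sym (cong proj₂ yy)) (trans (cong proj₁ eq) y↛y′)))
          (λ eq → true≢false (trans (sym (Y→X w-x₁ yy)) (trans (cong proj₁ eq) y↛y′)))
          x₂ (≢-sym (X-≢ w-x₂)) (≢-sym x₁≢x₂) (XY-≢ w-x₂ yy′))))
        (cong proj₂ w-x₂)))

    complete : ∀ {u v} → w ≢ u → w ≢ v → u ≢ v → A u v ≡ true
    complete {u} {v} w≢u w≢v u≢v with X⊎Y u w≢u | X⊎Y v w≢v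
    ... | inj₁ xu | inj₁ xv = X-complete xu xv u≢v
    ... | inj₁ xu | inj₂ yv = X→Y xu yv
    ... | inj₂ yu | inj₁ xv = Y→X xv yu
    ... | inj₂ yu | inj₂ yv = Y-complete yu yv u≢v

    -- The bit `A v w` distinguishes `X` from `Y` and hence determines `A w v`; it can therefore
    -- serve as the colour of `v`.
    out : ∀ {v} → w ≢ v → A w v ≡ (if A v w then back else true)
    out {v} w≢v with X⊎Y v w≢v
    ... | inj₁ xv rewrite cong proj₂ xv = cong proj₁ xv
    ... | inj₂ yv rewrite cong proj₂ yv = cong proj₁ yv

    -- One construction for both values of `back`: `w` gets colour `k`, and any other `v` gets
    -- colour `c (A v w)`.
    hub : ∀ {M : Digraph (Fin 3)} {u} (k : Fin 3) (c : Bool → Fin 3) →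
      (∀ i → i ≡ k ⊎ ∃[ b ] c b ≡ i) → (∀ b → c b ≢ k) → (∀ i → u i ≡ true → i ≡ k) →
      (∀ b → M k (c b) ≡ (if b then back else true)) → (∀ b → M (c b) k ≡ b) → (∀ b b′ → M (c b) (c b′) ≡ true) →
      BlowUp M u A
    hub {M} {u} k c c-onto c≢k u-k M-out M-in M-rest = record
      { colour = λ v → colour v (w ≟ v)
      ; onto   = onto
      ; single = λ x y eq one → single (w ≟ x) (w ≟ y) eq (u-k _ one)
      ; arcs   = λ x y → arcs (w ≟ x) (w ≟ y)
      }
      where
      colour : ∀ v → Dec (w ≡ v) → Fin 3
      colour v (yes _) = k
      colour v (no _) = c (A v w)

      colour-out : ∀ {v} → w ≢ v → colour v (w ≟ v) ≡ c (A v w)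
      colour-out {v} w≢v with w ≟ v
      ... | yes w≡v = contradiction w≡v w≢v
      ... | no _ = refl

      onto : ∀ i → ∃[ v ] colour v (w ≟ v) ≡ i
      onto i with c-onto i
      ... | inj₂ (true , refl) = y₀ , trans (colour-out (Y-≢ Y-y₀)) (cong c y₀→w)
      ... | inj₂ (false , refl) = x₁ , trans (colour-out (X-≢ w-x₁)) (cong c (cong proj₂ w-x₁))
      ... | inj₁ refl = w , at-w (w ≟ w)
        where
        at-w : (p : Dec (w ≡ w)) → colour w p ≡ k
        at-w (yes _) = refl
        at-w (no w≢w) = contradiction refl w≢w

      single : ∀ {x y} (p : Dec (w ≡ x)) (q : Dec (w ≡ y)) → colour x p ≡ colour y q → colour x p ≡ k → x ≡ y
      single (yes refl) (yes refl) _ _ = refl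
      single (no _) _ _ one = contradiction one (c≢k _)
      single (yes _) (no _) eq _ = contradiction (sym eq) (c≢k _)

      arcs : ∀ {x y} (p : Dec (w ≡ x)) (q : Dec (w ≡ y)) → x ≢ y → A x y ≡ M (colour x p) (colour y q)
      arcs (yes refl) (yes refl) x≢y = contradiction refl x≢y
      arcs (yes refl) (no w≢y) _ = trans (out w≢y) (sym (M-out _))
      arcs (no w≢x) (yes refl) _ = sym (M-in _)
      arcs (no w≢x) (no w≢y) x≢y = trans (complete w≢x w≢y x≢y) (sym (M-rest _ _))

    blowUp : BlowUp (fill G1 everywhere) only0 A ⊎ BlowUp (fill G2 everywhere) only2 A
    blowUp with back in back-eq
    ... | false = inj₁ (hub 0F (λ b → if b then 2F else 1F)
      (λ { 0F → inj₁ refl ; 1F → inj₂ (false , refl) ; 2F → inj₂ (true , refl) })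
      (λ { true () ; false () }) (λ { 0F _ → refl })
      (λ { true → sym back-eq ; false → refl }) (λ { true → refl ; false → refl })
      (λ { true true → refl ; true false → refl ; false true → refl ; false false → refl }))
    ... | true = inj₂ (hub 2F (λ b → if b then 1F else 0F)
      (λ { 2F → inj₁ refl ; 0F → inj₂ (false , refl) ; 1F → inj₂ (true , refl) })
      (λ { true () ; false () }) (λ { 2F _ → refl })
      (λ { true → sym back-eq ; false → refl }) (λ { true → refl ; false → refl })
      (λ { true true → refl ; true false → refl ; false true → refl ; false false → refl }))

  -- No vertex with two out-only or two in-only neighbours.

  module OneWay (4≤n : 4 ≤ n)
    (one-out : ∀ {w x y} → τ A w x ≡ (true , false) → τ A w y ≡ (true , false) → x ≡ y)
    (one-in : ∀ {w x y} → τ A w x ≡ (false , true) → τ A w y ≡ (false , true) → x ≡ y)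
    {a b : Fin n} (a-b : τ A a b ≡ (true , false)) where

    private
      a≢b : a ≢ b
      a≢b = arc-≢ (cong proj₁ a-b)

      b-detour : ∃[ m ] (A b m ≡ true × A m a ≡ true)
      b-detour = detour (≢-sym a≢b) (cong proj₂ a-b)

      p : Fin n
      p = proj₁ b-detour
      b→p = proj₁ (proj₂ b-detour)
      p→a = proj₂ (proj₂ b-detour)

      p≢a : p ≢ a
      p≢a = arc-≢ p→a

      p≢b : p ≢ b
      p≢b = ≢-sym (arc-≢ b→p)

      fourth : ∃[ q ] (q ≢ a × q ≢ b × q ≢ p)
      fourth with outsider (triple a b p) (subst (_< n) (sym (∣triple∣ a≢b (≢-sym p≢a) (≢-sym p≢b))) 4≤n)
      ... | q , q∉ = q , ∉-triple⁻ q∉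

      q : Fin n
      q = proj₁ fourth
      q≢a = proj₁ (proj₂ fourth)
      q≢b = proj₁ (proj₂ (proj₂ fourth))
      q≢p = proj₂ (proj₂ (proj₂ fourth))

      -- The types of `b` and `p` are the two types at `a`, and `b` is the only out-only neighbour
      -- of `a`.
      a-alike : ∀ {v} → v ≢ a → v ≢ b → τ A a v ≡ τ A a p
      a-alike {v} v≢a v≢b with two-types {a} {b} {p} a≢b (≢-sym p≢a)
          (λ eq → true≢false (trans (sym p→a) (trans (sym (cong proj₂ eq)) (cong proj₂ a-b)))) v (≢-sym v≢a)
      ... | inj₁ eq = contradiction (one-out (trans eq a-b) a-b) v≢b
      ... | inj₂ eq = eq

      b-alike : ∀ {v} → v ≢ a → v ≢ b → τ A b v ≡ τ A b p
      b-alike {v} v≢a v≢b with two-types {b} {a} {p} (≢-sym a≢b) (≢-sym p≢b)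
          (λ eq → true≢false (trans (sym b→p) (trans (sym (cong proj₁ eq)) (cong proj₂ a-b)))) v (≢-sym v≢b)
      ... | inj₁ eq = contradiction (one-in (trans eq (cong swap a-b)) (cong swap a-b)) v≢a
      ... | inj₂ eq = eq

      -- Otherwise `p` and the fourth vertex `q` would be two in-only neighbours of `a`.
      a→p : A a p ≡ true
      a→p = Bool.¬-not λ a↛p →
        q≢p (one-in (trans (a-alike q≢a q≢b) (cong₂ _,_ a↛p p→a)) (cong₂ _,_ a↛p p→a))

      p→b : A p b ≡ true
      p→b = Bool.¬-not λ p↛b →
        q≢p (one-out (trans (b-alike q≢a q≢b) (cong₂ _,_ b→p p↛b)) (cong₂ _,_ b→p p↛b))

      a-joined : ∀ {v} → v ≢ a → v ≢ b → τ A a v ≡ (true , true)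
      a-joined v≢a v≢b = trans (a-alike v≢a v≢b) (cong₂ _,_ a→p p→a)

      b-joined : ∀ {v} → v ≢ a → v ≢ b → τ A b v ≡ (true , true)
      b-joined v≢a v≢b = trans (b-alike v≢a v≢b) (cong₂ _,_ b→p p→b)

      rest-twins : ∀ {x y} → x ≢ a → x ≢ b → y ≢ a → y ≢ b → Twins A b x y
      rest-twins x≢a x≢b y≢a y≢b = split-twins (≢-sym x≢a) (≢-sym y≢a) a≢b (apart x≢a x≢b) (apart y≢a y≢b)
        where
        apart : ∀ {v} → v ≢ a → v ≢ b → τ A a v ≢ τ A a b
        apart v≢a v≢b eq = true≢false (trans (sym (cong proj₂ (a-joined v≢a v≢b))) (trans (cong proj₂ eq) (cong proj₂ a-b)))

      a→b = cong proj₁ a-b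
      b↛a = cong proj₂ a-b

      module Uniform (symmetric : A p q ≡ A q p) where

        -- Ends are replaced by twins: the head by `q`, then the tail by `p`. If the tail already is
        -- `q`, the head is replaced by `p` and symmetry turns the pair around.
        uniform : ∀ {u v} → u ≢ a → u ≢ b → v ≢ a → v ≢ b → u ≢ v → A u v ≡ A p q
        uniform {u} {v} u≢a u≢b v≢a v≢b u≢v with u ≟ q
        ... | no u≢q = trans u→q (p→q (u ≟ p))
          where
          u→q : A u v ≡ A u q
          u→q = cong proj₁ (rest-twins v≢a v≢b q≢a q≢b u u≢v u≢q u≢b)
          p→q : Dec (u ≡ p) → A u q ≡ A p q
          p→q (yes refl) = refl
          p→q (no _) = cong proj₂ (rest-twins u≢a u≢b p≢a p≢b q (≢-sym u≢q) q≢p q≢b)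
        ... | yes refl = trans (q→p (v ≟ p)) (sym symmetric)
          where
          q→p : Dec (v ≡ p) → A q v ≡ A q p
          q→p (yes refl) = refl
          q→p (no _) = cong proj₁ (rest-twins v≢a v≢b p≢a p≢b q u≢v q≢p q≢b)

        -- The only one-way arc of `G2` goes from 2 to 0, which fixes the places of `a` and `b`.
        data Position : Fin n → Fin 3 → Set where
          at-b : Position b 0F
          at-a : Position a 2F
          in-rest : ∀ {v} → v ≢ a → v ≢ b → Position v 1F

        position : ∀ v → ∃ (Position v)
        position v with v ≟ a | v ≟ b
        ... | yes refl | _ = 2F , at-a
        ... | no _ | yes refl = 0F , at-b
        ... | no v≢a | no v≢b = 1F , in-rest v≢a v≢b

        position-unique : ∀ {v i j} → Position v i → Position v j → i ≡ j
        position-unique at-b at-b = refl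
        position-unique at-b at-a = contradiction refl a≢b
        position-unique at-b (in-rest _ b≢b) = contradiction refl b≢b
        position-unique at-a at-b = contradiction refl a≢b
        position-unique at-a at-a = refl
        position-unique at-a (in-rest a≢a _) = contradiction refl a≢a
        position-unique (in-rest _ b≢b) at-b = contradiction refl b≢b
        position-unique (in-rest a≢a _) at-a = contradiction refl a≢a
        position-unique (in-rest _ _) (in-rest _ _) = refl

        uniform-blowUp : (d u : Fin 3 → Bool) → A p q ≡ d 1F → u 1F ≡ false → BlowUp (fill G2 d) u A
        uniform-blowUp d u inner u-rest = record
          { colour = λ v → proj₁ (position v)
          ; onto   = λ { 0F → b , position-unique (proj₂ (position b)) at-b
                       ; 1F → p , position-unique (proj₂ (position p)) (in-rest p≢a p≢b)
                       ; 2F → a , position-unique (proj₂ (position a)) at-a }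
          ; single = λ x y → single (proj₂ (position x)) (proj₂ (position y))
          ; arcs   = λ x y → arcs (proj₂ (position x)) (proj₂ (position y))
          }
          where
          single : ∀ {x y i j} → Position x i → Position y j → i ≡ j → u i ≡ true → x ≡ y
          single at-b at-b _ _ = refl
          single at-a at-a _ _ = refl
          single (in-rest _ _) _ _ one = contradiction (trans (sym one) u-rest) true≢false
          single at-b (in-rest _ _) () _
          single at-a (in-rest _ _) () _
          single at-b at-a () _
          single at-a at-b () _

          arcs : ∀ {x y i j} → Position x i → Position y j → x ≢ y → A x y ≡ fill G2 d i j
          arcs at-b at-b x≢y = contradiction refl x≢y
          arcs at-b at-a _ = b↛a
          arcs at-b (in-rest v≢a v≢b) _ = cong proj₁ (b-joined v≢a v≢b)
          arcs at-a at-b _ = a→b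
          arcs at-a at-a x≢y = contradiction refl x≢y
          arcs at-a (in-rest v≢a v≢b) _ = cong proj₁ (a-joined v≢a v≢b)
          arcs (in-rest v≢a v≢b) at-b _ = cong proj₂ (b-joined v≢a v≢b)
          arcs (in-rest v≢a v≢b) at-a _ = cong proj₂ (a-joined v≢a v≢b)
          arcs (in-rest u≢a u≢b) (in-rest v≢a v≢b) x≢y = trans (uniform u≢a u≢b v≢a v≢b x≢y) inner

      -- A further vertex would form with `p` and `q` three mutual twins, making the pair `p`, `q`
      -- symmetric.
      only-four : A p q ≢ A q p → ∀ v → v ≢ a → v ≢ b → v ≢ p → v ≡ q
      only-four asymmetric v v≢a v≢b v≢p with v ≟ q
      ... | yes v≡q = v≡q
      ... | no v≢q = contradiction (three-twins-symmetric (≢-sym q≢p) (≢-sym v≢p) (≢-sym v≢q)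
              (≢-sym p≢b) (≢-sym q≢b) (≢-sym v≢b) (rest-twins p≢a p≢b q≢a q≢b) (rest-twins p≢a p≢b v≢a v≢b)
              (rest-twins q≢a q≢b v≢a v≢b)) asymmetric

      four-blowUp : (v : Fin 4 → Fin n) → (∀ x → ∃[ i ] v i ≡ x) →
        (∀ i j → A (v i) (v j) ≡ G2[K1,P2,K1] i j) → (∀ i j → v i ≡ v j → i ≡ j) →
        BlowUp G2[K1,P2,K1] (λ _ → true) A
      four-blowUp v covers v-arcs v-injective = record
        { colour = λ x → proj₁ (covers x)
        ; onto   = λ i → v i , v-injective _ i (proj₂ (covers (v i)))
        ; single = λ x y eq _ → trans (sym (proj₂ (covers x))) (trans (cong v eq) (proj₂ (covers y)))
        ; arcs   = λ x y _ → trans (sym (cong₂ A (proj₂ (covers x)) (proj₂ (covers y)))) (v-arcs _ _)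
        }

      path-blowUp : ∀ {r s} → r ≢ a → r ≢ b → s ≢ a → s ≢ b → A r s ≡ true → A s r ≡ false →
        (∀ v → v ≢ a → v ≢ b → v ≢ r → v ≡ s) → BlowUp G2[K1,P2,K1] (λ _ → true) A
      path-blowUp {r} {s} r≢a r≢b s≢a s≢b r→s s↛r rest = four-blowUp vertex covers vertex-arcs injective
        where
        vertex : Fin 4 → Fin n
        vertex 0F = b
        vertex 1F = r
        vertex 2F = s
        vertex 3F = a

        covers : ∀ x → ∃[ i ] vertex i ≡ x
        covers x with x ≟ b | x ≟ a | x ≟ r
        ... | yes refl | _ | _ = 0F , refl
        ... | no _ | yes refl | _ = 3F , refl
        ... | no _ | no _ | yes refl = 1F , refl
        ... | no x≢b | no x≢a | no x≢r = 2F , sym (rest x x≢a x≢b x≢r)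

        vertex-arcs : ∀ i j → A (vertex i) (vertex j) ≡ G2[K1,P2,K1] i j
        vertex-arcs 0F 0F = loopless b
        vertex-arcs 0F 1F = cong proj₁ (b-joined r≢a r≢b)
        vertex-arcs 0F 2F = cong proj₁ (b-joined s≢a s≢b)
        vertex-arcs 0F 3F = b↛a
        vertex-arcs 1F 0F = cong proj₂ (b-joined r≢a r≢b)
        vertex-arcs 1F 1F = loopless r
        vertex-arcs 1F 2F = r→s
        vertex-arcs 1F 3F = cong proj₂ (a-joined r≢a r≢b)
        vertex-arcs 2F 0F = cong proj₂ (b-joined s≢a s≢b)
        vertex-arcs 2F 1F = s↛r
        vertex-arcs 2F 2F = loopless s
        vertex-arcs 2F 3F = cong proj₂ (a-joined s≢a s≢b)
        vertex-arcs 3F 0F = a→b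
        vertex-arcs 3F 1F = cong proj₁ (a-joined r≢a r≢b)
        vertex-arcs 3F 2F = cong proj₁ (a-joined s≢a s≢b)
        vertex-arcs 3F 3F = loopless a

        injective : ∀ i j → vertex i ≡ vertex j → i ≡ j
        injective 0F 0F _ = refl
        injective 0F 1F eq = contradiction (sym eq) r≢b
        injective 0F 2F eq = contradiction (sym eq) s≢b
        injective 0F 3F eq = contradiction (sym eq) a≢b
        injective 1F 0F eq = contradiction eq r≢b
        injective 1F 1F _ = refl
        injective 1F 2F eq = contradiction eq (arc-≢ r→s)
        injective 1F 3F eq = contradiction eq r≢a
        injective 2F 0F eq = contradiction eq s≢b
        injective 2F 1F eq = contradiction (sym eq) (arc-≢ r→s)
        injective 2F 2F _ = refl
        injective 2F 3F eq = contradiction eq s≢a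
        injective 3F 0F eq = contradiction eq a≢b
        injective 3F 1F eq = contradiction (sym eq) r≢a
        injective 3F 2F eq = contradiction (sym eq) s≢a
        injective 3F 3F _ = refl

    shape : Shape A
    shape with A p q in pq | A q p in qp
    -- The digraph is `G2` with fibres `K 1`, `K (n ∸ 2)`, `K 1`, the case `t = n ∸ 2` of this
    -- family.
    ... | true | true = G2-K1-K-K (uniform-blowUp everywhere only0 pq refl)
      where open Uniform (trans pq (sym qp))
    ... | false | false = G2-K1-Kbar-K1 (uniform-blowUp only02 only02 pq refl)
      where open Uniform (trans pq (sym qp))
    ... | true | false = G2-K1-P2-K1 (path-blowUp p≢a p≢b q≢a q≢b pq qp
            (only-four λ eq → true≢false (trans (sym pq) (trans eq qp))))
    ... | false | true = G2-K1-P2-K1 (path-blowUp q≢a q≢b p≢a p≢b qp pq rest)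
      where
      rest : ∀ v → v ≢ a → v ≢ b → v ≢ q → v ≡ p
      rest v v≢a v≢b v≢q with v ≟ p
      ... | yes v≡p = v≡p
      ... | no v≢p = contradiction (only-four (λ eq → true≢false (trans (sym qp) (trans (sym eq) pq))) v v≢a v≢b v≢p) v≢q

-- Reversal of arcs and assembly of the cases.

twin-triples-reverse : {A : Digraph (Fin n)} → TwinTriples A → TwinTriples (flip A)
twin-triples-reverse triples x y z x≢y x≢z y≢z =
  ⊎-map twins-reverse (⊎-map twins-reverse twins-reverse) (triples x y z x≢y x≢z y≢z)
  where
  twins-reverse : ∀ {z x y} → Twins _ z x y → Twins _ z x y
  twins-reverse t w w≢x w≢y w≢z = cong swap (t w w≢x w≢y w≢z)

diameter-reverse : {A : Digraph (Fin n)} → Diameter≤2 A → Diameter≤2 (flip A)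
diameter-reverse diam x y x≢y with diam y x (≢-sym x≢y)
... | inj₁ a = inj₁ a
... | inj₂ (m , a , b) = inj₂ (m , b , a)

HasFan : Digraph (Fin n) → Set
HasFan A = ∃[ w ] ∃[ x ] ∃[ y ] (x ≢ y × τ A w x ≡ (true , false) × τ A w y ≡ (true , false))

hasFan? : (A : Digraph (Fin n)) → Dec (HasFan A)
hasFan? A = any? λ w → any? λ x → any? λ y →
  ¬? (x ≟ y) ×-dec ≡-dec Bool._≟_ Bool._≟_ (τ A w x) _ ×-dec ≡-dec Bool._≟_ Bool._≟_ (τ A w y) _

no-fan : {A : Digraph (Fin n)} → ¬ HasFan A →
  ∀ {w x y} → τ A w x ≡ (true , false) → τ A w y ≡ (true , false) → x ≡ y
no-fan ¬fan {w} {x} {y} wx wy with x ≟ y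
... | yes x≡y = x≡y
... | no x≢y = contradiction (w , x , y , x≢y , wx , wy) ¬fan

classification : {A : Digraph (Fin n)} → 4 ≤ n → Loopless A → ∀ {a b} → A a b ≡ true → A b a ≡ false →
  TwinTriples A → Diameter≤2 A → Shape A
classification {A = A} 4≤n loopless a→b b↛a triples diam with hasFan? A | hasFan? (flip A)
... | yes (w , x , y , x≢y , wx , wy) | _ =
  [ G1-K1-K-K , G2-K-K-K1 ]′ (Fan.blowUp x≢y wx wy)
  where open Views loopless triples diam
... | no _ | yes (w , x , y , x≢y , wx , wy) =
  -- Exchanging 1 and 2 turns the reverse of `G1` back into `G1`. For `G2` the exchange is of 0 and
  -- 2, which moves the single vertex from the last place to the first.
  [ (λ b → G1-K1-K-K (blowUp-reverse b (λ { 0F → 0F ; 1F → 2F ; 2F → 1F })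
       (λ { 0F → refl ; 1F → refl ; 2F → refl }) (λ { 0F → refl ; 1F → refl ; 2F → refl })
       λ { 0F 0F → refl ; 0F 1F → refl ; 0F 2F → refl ; 1F 0F → refl ; 1F 1F → refl ; 1F 2F → refl
         ; 2F 0F → refl ; 2F 1F → refl ; 2F 2F → refl }))
  , (λ b → G2-K1-K-K (blowUp-reverse b (λ { 0F → 2F ; 1F → 1F ; 2F → 0F })
       (λ { 0F → refl ; 1F → refl ; 2F → refl }) (λ { 0F → refl ; 1F → refl ; 2F → refl })
       λ { 0F 0F → refl ; 0F 1F → refl ; 0F 2F → refl ; 1F 0F → refl ; 1F 1F → refl ; 1F 2F → refl
         ; 2F 0F → refl ; 2F 1F → refl ; 2F 2F → refl }))
  ]′ (Fan.blowUp x≢y wx wy)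
  where open Views {A = flip A} loopless (twin-triples-reverse triples) (diameter-reverse diam)
... | no ¬out | no ¬in = OneWay.shape 4≤n (no-fan ¬out)
        (λ wx wy → no-fan ¬in (cong swap wx) (cong swap wy)) (cong₂ _,_ a→b b↛a)
  where open Views loopless triples diam

one-way-arc : {A : Digraph (Fin n)} → ¬ Undirected A → ∃[ a ] ∃[ b ] (A a b ≡ true × A b a ≡ false)
one-way-arc {A = A} ¬undirected
  with any? (λ a → any? λ b → (A a b Bool.≟ true) ×-dec (A b a Bool.≟ false))
... | yes arc = arc
... | no ¬arc = contradiction (λ x y x→y → Bool.¬-not λ y↛x → ¬arc (x , y , x→y , y↛x)) ¬undirected

theorem4p2 : (n : ℕ) (A : Digraph (Fin n)) → 4 ≤ n → Loopless A → StronglyConnected A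
    → ¬ Undirected A → (HasDim A (n ∸ 2) ⇔ Extremal n A)
theorem4p2 n A 4≤n loopless connected ¬undirected with one-way-arc ¬undirected
... | a , b , a→b , b↛a = mk⇔
  (λ dim → case dim⇒twin-triples connected 4≤n dim of λ { (triples , diam) →
    shape⇒extremal loopless (classification 4≤n loopless a→b b↛a triples diam) })
  (λ extremal → case shape⇒twin-triples (extremal⇒shape 4≤n extremal) of λ { (triples , diam) →
    twin-triples⇒dim connected loopless a→b b↛a triples diam })
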